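{- Let $n\ge 1$ and let $\mathcal{E}(n)$ be the set of isomorphism classes of simple graphs on $n$ vertices. For $0\le d\le \binom n2$ let $h(d)$ be the number of members of $\mathcal{E}(n)$ with exactly $d$ edges. Then there exists a set $\mathcal{S}\subseteq\mathcal{E}(n)$ with $|\mathcal{S}|\le h\left(\left\lfloor \binom n2/2\right\rfloor\right)$ which is a generator/separator set for $\mathcal{E}(n)$, i.e. the map $x\mapsto (I(s)(x))_{s\in\mathcal S}$ is injective on $\mathcal{E}(n)$ (equivalently, for every $g\in\mathcal{E}(n)$ there is a function $f$ with $I(g)(x)=f((I(s)(x))_{s\in\mathcal S})$ for all $x\in\mathcal{E}(n)$).
   Context: For simple graphs $g,x$ on $n$ vertices, $I(g)(x)$ is the number of subgraphs of $x$ (subsets of its edge set, on the same vertex set) isomorphic to $g$. -}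

module Defs where

open import Data.Bool using (Bool; true; false; if_then_else_)
open import Data.Nat using (ℕ; zero; suc; _≤_; ⌊_/2⌋)
open import Data.Nat.Base using (_<ᵇ_)
open import Data.Nat.Combinatorics using (_C_)
open import Data.Fin using (Fin; toℕ)
open import Data.Nat.ListAction using (sum)
open import Data.List using (List; []; _∷_; length; map; concatMap; filterᵇ; allFin)
open import Data.List.Relation.Unary.All using (All)
open import Data.List.Relation.Unary.Any using (Any)
open import Data.List.Relation.Unary.AllPairs using (AllPairs)
open import Data.Product using (Σ; _×_; _,_)
open import Function.Bundles using (_↔_; Inverse)
open import Relation.Binary.PropositionalEquality using (_≡_)
open import Relation.Nullary using (¬_)

record Graph (n : ℕ) : Set where
  field
    adj  : Fin n → Fin n → Bool
    sym  : ∀ i j → adj i j ≡ adj j i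
    irr  : ∀ i → adj i i ≡ false
open Graph public

_≅_ : ∀ {n} → Graph n → Graph n → Set
_≅_ {n} g h = Σ (Fin n ↔ Fin n) λ σ →
  ∀ i j → adj g i j ≡ adj h (Inverse.to σ i) (Inverse.to σ j)

_≗ᴳ_ : ∀ {n} → Graph n → Graph n → Set
g ≗ᴳ h = ∀ i j → adj g i j ≡ adj h i j

_⊆ᴳ_ : ∀ {n} → Graph n → Graph n → Set
y ⊆ᴳ x = ∀ i j → adj y i j ≡ true → adj x i j ≡ true

edgeCount : ∀ {n} → Graph n → ℕ
edgeCount {n} g =
  sum (concatMap (λ i → map (λ j → if adj g i j then 1 else 0)
                            (filterᵇ (λ j → toℕ i <ᵇ toℕ j) (allFin n)))
                 (allFin n))

NumClasses : {A : Set} → (A → A → Set) → (A → Set) → ℕ → Set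
NumClasses {A} _≈_ P k = Σ (List A) λ L →
  All P L × AllPairs (λ a b → ¬ (a ≈ b)) L ×
  (∀ a → P a → Any (λ b → a ≈ b) L) × length L ≡ k

ICount : ∀ {n} → Graph n → Graph n → ℕ → Set
ICount g x k = NumClasses _≗ᴳ_ (λ y → (y ⊆ᴳ x) × (y ≅ g)) k

HCount : (n d k : ℕ) → Set
HCount n d k = NumClasses (_≅_ {n}) (λ y → edgeCount y ≡ d) k

halfEdges : ℕ → ℕ
halfEdges n = ⌊ (n C 2) /2⌋

{-# OPTIONS --safe #-}
-- Identify graphs on n vertices with subsets of the N = n C 2 edges.  For a graph x let K(g) be the number
-- of labelled copies of x containing g.  By double counting, |orbit g| K(g) = |orbit x| I(g)(x), and
-- Σ_{w covering g} K(w) = (|x| − |g|) K(g).  So for two graphs x, y with equally many edges, the suitably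
-- normalised difference f of their K's satisfies: if f vanishes on level d (graphs with d edges), then
-- Df = 0 there, where (Df)(g) = Σ_{w covering g} f(w).  By the identity
-- |Df|² − |Uf|² = Σ_v (2|v| − N) f(v)², D is injective on level d when 2d > N, and the transpose U of D is
-- injective on level d when 2d < N.  The latter makes the h(d) equations Df = 0 on isomorphism classes
-- independent, so by Gaussian elimination h(d+1) − h(d) of the classes with d+1 edges force f = 0 on level
-- d+1.  Taking all classes with one edge and telescoping up to ⌊N/2⌋ gives h(⌊N/2⌋) separators: above that
-- level f vanishes by injectivity of D, and f(x) = 0 means that x is isomorphic to y.
module Submission where

open import Defs
open import Data.Bool using (Bool; true; false; _∧_; if_then_else_)
import Data.Bool.Properties as Bool
open import Data.Empty using (⊥; ⊥-elim)
open import Data.Fin using (Fin; zero; suc; punchIn; toℕ; finToFun; funToFin)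
open import Data.Fin.Properties using (any?; all?; injective⇒≤; finToFun-funToFin)
import Data.Fin.Properties as Fin
open import Data.Integer using (ℤ; +_; -[1+_]; 0ℤ; 1ℤ; _+_; _*_; _-_; -_)
import Data.Integer as ℤ
import Data.Integer.Properties as ℤ
open import Data.Integer.Tactic.RingSolver using (solve-∀)
open import Data.List using
  (List; []; _∷_; length; map; _++_; filter; filterᵇ; concatMap; allFin; lookup; deduplicate)
import Data.List as List
open import Data.List.Membership.Propositional using (_∈_)
open import Data.List.Membership.Propositional.Properties using
  (∈-map⁺; ∈-map⁻; ∈-++⁺ˡ; ∈-++⁺ʳ; ∈-filter⁺; ∈-lookup; ∈-allFin)
import Data.List.Membership.Setoid.Properties as SetoidMembership
open import Data.List.Properties using
  (length-map; length-++; length-tabulate; map-tabulate; map-∘; concatMap-cong; concatMap-map; filter-++)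
open import Data.List.Relation.Unary.All as All using (All; []; _∷_)
import Data.List.Relation.Unary.All.Properties as All
open import Data.List.Relation.Unary.AllPairs as AllPairs using (AllPairs; []; _∷_)
import Data.List.Relation.Unary.AllPairs.Properties as AllPairs
open import Data.List.Relation.Unary.Any as Any using (Any; here; there)
import Data.List.Relation.Unary.Any.Properties as Any
open import Data.List.Relation.Unary.Unique.DecSetoid.Properties using (deduplicate-!)
open import Data.List.Relation.Unary.Unique.Propositional using (Unique)
import Data.List.Relation.Unary.Unique.Propositional.Properties as Unique
open import Data.Nat using (ℕ; zero; suc; _≤_; ⌊_/2⌋)
import Data.Nat as ℕ
open import Data.Nat.Combinatorics using (_C_; nCk+nC[k+1]≡[n+1]C[k+1]; nC1≡n)
open import Data.Nat.ListAction using () renaming (sum to sumᴸ)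
open import Data.Nat.ListAction.Properties using (sum-++)
import Data.Nat.Properties as ℕ
open import Data.Product using (Σ; _×_; _,_; proj₁; proj₂)
open import Data.Sum using (_⊎_; inj₁; inj₂)
open import Data.Vec using (Vec; []; _∷_; replicate)
import Data.Vec as Vec
open import Data.Vec.Functional using (insertAt)
open import Data.Vec.Functional.Properties using (insertAt-lookup; insertAt-punchIn)
import Data.Vec.Properties as Vec
open import Function using (_∘_; mk⇔)
open import Function.Bundles using (_↔_; Inverse; mk↔ₛ′)
open import Function.Properties.Inverse using (↔-refl; ↔-sym; ↔-trans)
open import Relation.Binary using (tri<; tri≈; tri>; IsEquivalence; DecSetoid)
import Relation.Binary.Construct.On as On
open import Relation.Binary.PropositionalEquality as ≡ using (_≡_; _≢_; refl; cong; cong₂; trans)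
open import Relation.Nullary using (¬_; Dec; yes; no; ¬?; does)
open import Relation.Nullary.Decidable using
  (dec-true; dec-false; decidable-stable; does-⇔; _×-dec_; map′)
open import Algebra.Properties.Semiring.Sum ℤ.+-*-semiring using
  (sum; sum-remove; sum-cong-≗; ∑-distrib-+; *-distribˡ-sum; sum-replicate-zero)
open ≡.≡-Reasoning

-- Gaussian elimination

*-nonzero-cancel : ∀ {a b} → a ≢ 0ℤ → a * b ≡ 0ℤ → b ≡ 0ℤ
*-nonzero-cancel {a} a≢0 eq with ℤ.i*j≡0⇒i≡0∨j≡0 a eq
... | inj₁ a≡0 = ⊥-elim (a≢0 a≡0)
... | inj₂ b≡0 = b≡0

sum-zero : ∀ {n} {f : Fin n → ℤ} → (∀ i → f i ≡ 0ℤ) → sum f ≡ 0ℤ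
sum-zero {n} f≡0 = trans (sum-cong-≗ f≡0) (sum-replicate-zero n)

-- A combination `α` of reduced rows is a combination of the original rows: each other row is taken
-- `a * α r` times, and the pivot row, with entry `y`, collects all the multiples that were
-- subtracted.
sum-rowOp : ∀ {n} (α m x : Fin n → ℤ) a y →
  - sum (λ r → α r * m r) * y + sum (λ r → a * α r * x r) ≡
  sum (λ r → α r * (a * x r - m r * y))
sum-rowOp {zero}  α m x a y = lemma y
  where lemma : ∀ y → - 0ℤ * y + 0ℤ ≡ 0ℤ
        lemma = solve-∀
sum-rowOp {suc n} α m x a y = trans
  (lemma (α zero) (m zero) (x zero) a y _ _)
  (cong (_+_ (α zero * (a * x zero - m zero * y))) (sum-rowOp (λ r → α (suc r)) (λ r → m (suc r)) (λ r → x (suc r)) a y))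
  where lemma : ∀ α m x a y s t → - (α * m + s) * y + (a * α * x + t) ≡
                                  α * (a * x - m * y) + (- s * y + t)
        lemma = solve-∀

sum-linear : ∀ {n} (x y v : Fin n → ℤ) a b →
  sum (λ c → (a * x c - b * y c) * v c) ≡ a * sum (λ c → x c * v c) - b * sum (λ c → y c * v c)
sum-linear {zero}  x y v a b = lemma a b
  where lemma : ∀ a b → 0ℤ ≡ a * 0ℤ - b * 0ℤ
        lemma = solve-∀
sum-linear {suc n} x y v a b = trans
  (cong (_+_ ((a * x zero - b * y zero) * v zero)) (sum-linear (λ c → x (suc c)) (λ c → y (suc c)) (λ c → v (suc c)) a b))
  (lemma (x zero) (y zero) (v zero) a b _ _)
  where lemma : ∀ x y v a b s t → (a * x - b * y) * v + (a * s - b * t) ≡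
                                  a * (x * v + s) - b * (y * v + t)
        lemma = solve-∀

IndependentRows : ∀ {p q} → (Fin p → Fin q → ℤ) → Set
IndependentRows {p} {q} M = ∀ (a : Fin p → ℤ) → (∀ c → sum (λ i → a i * M i c) ≡ 0ℤ) → ∀ i → a i ≡ 0ℤ

-- By linearity this says that a kernel vector is fixed by its entries in `S`.
DetermineKernel : ∀ {p q} → (Fin p → Fin q → ℤ) → List (Fin q) → Set
DetermineKernel {p} {q} M S = ∀ (v : Fin q → ℤ) → (∀ i → sum (λ c → M i c * v c) ≡ 0ℤ) →
  (∀ c → c ∈ S → v c ≡ 0ℤ) → ∀ c → v c ≡ 0ℤ

-- Fraction-free Gaussian elimination; the selected columns are the free ones.
freeColumns : ∀ p q (M : Fin p → Fin q → ℤ) → IndependentRows M →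
  Σ (List (Fin q)) λ S → length S ℕ.+ p ≡ q × DetermineKernel M S
freeColumns zero q M _ = allFin q ,
  trans (ℕ.+-identityʳ _) (length-tabulate (λ i → i)) ,
  λ v _ v≡0 c → v≡0 c (∈-allFin c)
-- Without columns the all-ones combination of rows vanishes vacuously, so independence would give 1
-- = 0.
freeColumns (suc p) zero M indep with () ← indep (λ _ → 1ℤ) (λ ()) zero
freeColumns (suc p) (suc q) M indep with any? (λ i → ¬? (M i zero ℤ.≟ 0ℤ))
-- The first column is zero, hence free, and the rows stay independent without it.
... | no ¬pivot = zero ∷ map suc S ,
  cong suc (trans (cong (ℕ._+ suc p) (length-map suc S)) size) , determined
  where
    column≡0 : ∀ i → M i zero ≡ 0ℤ
    column≡0 i = decidable-stable (M i zero ℤ.≟ 0ℤ) (λ ≢0 → ¬pivot (i , ≢0))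
    indep′ : IndependentRows (λ i c → M i (suc c))
    indep′ a eqs = indep a λ where
      zero    → sum-zero (λ i → trans (cong (a i *_) (column≡0 i)) (ℤ.*-zeroʳ (a i)))
      (suc c) → eqs c
    rec = freeColumns (suc p) q (λ i c → M i (suc c)) indep′
    S = proj₁ rec
    size = proj₁ (proj₂ rec)
    determined : DetermineKernel M (zero ∷ map suc S)
    determined v eqs v≡0 zero    = v≡0 zero (here refl)
    determined v eqs v≡0 (suc c) = proj₂ (proj₂ rec) (λ c → v (suc c))
      (λ i → let rest = sum (λ c → M i (suc c) * v (suc c)) in begin
        rest                      ≡⟨ lemma (M i zero) rest ⟩
        M i zero * 0ℤ + rest      ≡⟨ cong (λ z → M i zero * z + rest) (v≡0 zero (here refl)) ⟨
        M i zero * v zero + rest  ≡⟨ eqs i ⟩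
        0ℤ                        ∎)
      (λ c c∈S → v≡0 (suc c) (there (∈-map⁺ suc c∈S))) c
      where lemma : ∀ a s → s ≡ a * 0ℤ + s
            lemma = solve-∀
-- Row `i` expresses the first variable through the others. The remaining rows are multiplied by the
-- pivot `a` before subtracting, which avoids division.
... | yes (i , a≢0) = map suc S ,
  trans (cong (ℕ._+ suc p) (length-map suc S)) (trans (ℕ.+-suc _ p) (cong suc size)) , determined
  where
    a = M i zero
    m : Fin p → ℤ
    m r = M (punchIn i r) zero
    M′ : Fin p → Fin (suc q) → ℤ
    M′ r c = a * M (punchIn i r) c - m r * M i c
    indep′ : IndependentRows (λ r c → M′ r (suc c))
    indep′ α eqs r = *-nonzero-cancel a≢0 (trans (≡.sym (insertAt-punchIn _ i _ r)) (indep β βM≡0 (punchIn i r)))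
      where
        -- The coefficients for `M` that reproduce the combination `α` of the rows of `M′`, as in
        -- `sum-rowOp`.
        β : Fin (suc p) → ℤ
        β = insertAt (λ r → a * α r) i (- sum (λ r → α r * m r))
        βM : ∀ c → sum (λ k → β k * M k c) ≡ sum (λ r → α r * M′ r c)
        βM c = begin
          sum (λ k → β k * M k c) ≡⟨ sum-remove {i = i} (λ k → β k * M k c) ⟩
          β i * M i c + sum (λ r → β (punchIn i r) * M (punchIn i r) c)
            ≡⟨ cong₂ _+_ (cong (_* M i c) (insertAt-lookup _ i _))
                 (sum-cong-≗ (λ r → cong (_* M (punchIn i r) c) (insertAt-punchIn _ i _ r))) ⟩
          - sum (λ r → α r * m r) * M i c + sum (λ r → a * α r * M (punchIn i r) c)
            ≡⟨ sum-rowOp α m (λ r → M (punchIn i r) c) a (M i c) ⟩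
          sum (λ r → α r * M′ r c) ∎
        βM≡0 : ∀ c → sum (λ k → β k * M k c) ≡ 0ℤ
        βM≡0 zero    = trans (βM zero) (sum-zero λ r → lemma (α r) a (m r))
          where lemma : ∀ α a m → α * (a * m - m * a) ≡ 0ℤ
                lemma = solve-∀
        βM≡0 (suc c) = trans (βM (suc c)) (eqs c)
    rec = freeColumns p q (λ r c → M′ r (suc c)) indep′
    S = proj₁ rec
    size = proj₁ (proj₂ rec)
    determined : DetermineKernel M (map suc S)
    determined v eqs v≡0 = λ where
        -- With all other entries zero, the pivot equation reduces to `a * v zero ≡ 0ℤ`.
        zero    → *-nonzero-cancel a≢0 (begin
          a * v zero                                        ≡⟨ ℤ.+-identityʳ _ ⟨
          a * v zero + 0ℤ                                   ≡⟨ cong (_+_ (a * v zero)) (sum-zero λ c →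
                                                                 trans (cong (M i (suc c) *_) (tail≡0 c)) (ℤ.*-zeroʳ (M i (suc c)))) ⟨
          a * v zero + sum (λ c → M i (suc c) * v (suc c))  ≡⟨ eqs i ⟩
          0ℤ                                                ∎)
        (suc c) → tail≡0 c
      where
        eqs′ : ∀ r → sum (λ c → M′ r (suc c) * v (suc c)) ≡ 0ℤ
        eqs′ r = begin
          sum (λ c → M′ r (suc c) * v (suc c))
            ≡⟨ sum-linear _ _ (λ c → v (suc c)) a (m r) ⟩
          a * s - m r * t
            ≡⟨ lemma a (m r) (v zero) s t ⟩
          a * (m r * v zero + s) - m r * (a * v zero + t)
            ≡⟨ cong₂ (λ x y → a * x - m r * y) (eqs (punchIn i r)) (eqs i) ⟩
          a * 0ℤ - m r * 0ℤ
            ≡⟨ lemma′ a (m r) ⟩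
          0ℤ ∎
          where
            s = sum (λ c → M (punchIn i r) (suc c) * v (suc c))
            t = sum (λ c → M i (suc c) * v (suc c))
            lemma : ∀ a m v s t → a * s - m * t ≡ a * (m * v + s) - m * (a * v + t)
            lemma = solve-∀
            lemma′ : ∀ a m → a * 0ℤ - m * 0ℤ ≡ 0ℤ
            lemma′ = solve-∀
        tail≡0 : ∀ c → v (suc c) ≡ 0ℤ
        tail≡0 = proj₂ (proj₂ rec) (λ c → v (suc c)) eqs′ (λ c c∈S → v≡0 (suc c) (∈-map⁺ suc c∈S))

-- Sums over the Boolean cube

Cube : ℕ → Set
Cube = Vec Bool

⟦_⟧ : Bool → ℤ
⟦ true ⟧  = 1ℤ
⟦ false ⟧ = 0ℤ

∑ᵛ : ∀ {n} → (Cube n → ℤ) → ℤ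
∑ᵛ {zero}  f = f []
∑ᵛ {suc n} f = ∑ᵛ (λ v → f (false ∷ v)) + ∑ᵛ (λ v → f (true ∷ v))

∑ᵛ-cong : ∀ {n} {f g : Cube n → ℤ} → (∀ v → f v ≡ g v) → ∑ᵛ f ≡ ∑ᵛ g
∑ᵛ-cong {zero}  f≗g = f≗g []
∑ᵛ-cong {suc n} f≗g = cong₂ _+_ (∑ᵛ-cong (λ v → f≗g (false ∷ v))) (∑ᵛ-cong (λ v → f≗g (true ∷ v)))

∑ᵛ-0 : ∀ n → ∑ᵛ {n} (λ _ → 0ℤ) ≡ 0ℤ
∑ᵛ-0 zero    = refl
∑ᵛ-0 (suc n) = cong₂ _+_ (∑ᵛ-0 n) (∑ᵛ-0 n)

∑ᵛ-zero : ∀ {n} {f : Cube n → ℤ} → (∀ v → f v ≡ 0ℤ) → ∑ᵛ f ≡ 0ℤ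
∑ᵛ-zero {n} f≡0 = trans (∑ᵛ-cong f≡0) (∑ᵛ-0 n)

∑ᵛ-+ : ∀ {n} (f g : Cube n → ℤ) → ∑ᵛ (λ v → f v + g v) ≡ ∑ᵛ f + ∑ᵛ g
∑ᵛ-+ {zero}  f g = refl
∑ᵛ-+ {suc n} f g = trans
  (cong₂ _+_ (∑ᵛ-+ (λ v → f (false ∷ v)) (λ v → g (false ∷ v))) (∑ᵛ-+ (λ v → f (true ∷ v)) (λ v → g (true ∷ v))))
  (lemma (∑ᵛ (λ v → f (false ∷ v))) _ _ _)
  where lemma : ∀ a b c d → (a + b) + (c + d) ≡ (a + c) + (b + d)
        lemma = solve-∀

∑ᵛ-*ˡ : ∀ {n} a (f : Cube n → ℤ) → ∑ᵛ (λ v → a * f v) ≡ a * ∑ᵛ f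
∑ᵛ-*ˡ {zero}  a f = refl
∑ᵛ-*ˡ {suc n} a f = trans
  (cong₂ _+_ (∑ᵛ-*ˡ a (λ v → f (false ∷ v))) (∑ᵛ-*ˡ a (λ v → f (true ∷ v))))
  (≡.sym (ℤ.*-distribˡ-+ a (∑ᵛ (λ v → f (false ∷ v))) _))

∑ᵛ-*ʳ : ∀ {n} a (f : Cube n → ℤ) → ∑ᵛ (λ v → f v * a) ≡ ∑ᵛ f * a
∑ᵛ-*ʳ a f = trans (∑ᵛ-cong (λ v → ℤ.*-comm (f v) a)) (trans (∑ᵛ-*ˡ a f) (ℤ.*-comm a (∑ᵛ f)))

∑ᵛ-swap : ∀ {m n} (f : Cube m → Cube n → ℤ) →
  ∑ᵛ (λ v → ∑ᵛ (λ w → f v w)) ≡ ∑ᵛ (λ w → ∑ᵛ (λ v → f v w))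
∑ᵛ-swap {zero}  f = refl
∑ᵛ-swap {suc m} f = trans
  (cong₂ _+_ (∑ᵛ-swap (λ v → f (false ∷ v))) (∑ᵛ-swap (λ v → f (true ∷ v))))
  (≡.sym (∑ᵛ-+ (λ w → ∑ᵛ (λ v → f (false ∷ v) w)) (λ w → ∑ᵛ (λ v → f (true ∷ v) w))))

sum-∑ᵛ-swap : ∀ {m n} (f : Fin m → Cube n → ℤ) →
  sum (λ i → ∑ᵛ (f i)) ≡ ∑ᵛ (λ v → sum (λ i → f i v))
sum-∑ᵛ-swap {n = zero}  f = refl
sum-∑ᵛ-swap {n = suc n} f = trans
  (∑-distrib-+ (λ i → ∑ᵛ (λ v → f i (false ∷ v))) (λ i → ∑ᵛ (λ v → f i (true ∷ v))))
  (cong₂ _+_ (sum-∑ᵛ-swap (λ i v → f i (false ∷ v))) (sum-∑ᵛ-swap (λ i v → f i (true ∷ v))))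

∑ᵛ-nonneg : ∀ {n} {f : Cube n → ℤ} → (∀ v → 0ℤ ℤ.≤ f v) → 0ℤ ℤ.≤ ∑ᵛ f
∑ᵛ-nonneg {zero}  0≤f = 0≤f []
∑ᵛ-nonneg {suc n} 0≤f = ℤ.+-mono-≤ (∑ᵛ-nonneg (λ v → 0≤f (false ∷ v))) (∑ᵛ-nonneg (λ v → 0≤f (true ∷ v)))

nonneg-+≡0 : ∀ {i j} → 0ℤ ℤ.≤ i → 0ℤ ℤ.≤ j → i + j ≡ 0ℤ → i ≡ 0ℤ × j ≡ 0ℤ
nonneg-+≡0 {+ zero} {+ zero} _ _ _ = refl , refl

∑ᵛ≡0⇒≡0 : ∀ {n} {f : Cube n → ℤ} → (∀ v → 0ℤ ℤ.≤ f v) → ∑ᵛ f ≡ 0ℤ → ∀ v → f v ≡ 0ℤ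
∑ᵛ≡0⇒≡0 {zero}  0≤f eq [] = eq
∑ᵛ≡0⇒≡0 {suc n} 0≤f eq (b ∷ v)
  with nonneg-+≡0 (∑ᵛ-nonneg (λ v → 0≤f (false ∷ v))) (∑ᵛ-nonneg (λ v → 0≤f (true ∷ v))) eq
∑ᵛ≡0⇒≡0 {suc n} 0≤f eq (false ∷ v) | p , _ = ∑ᵛ≡0⇒≡0 (λ v → 0≤f (false ∷ v)) p v
∑ᵛ≡0⇒≡0 {suc n} 0≤f eq (true ∷ v)  | _ , p = ∑ᵛ≡0⇒≡0 (λ v → 0≤f (true ∷ v)) p v

-- Order and covering relation of the cube

weight : ∀ {n} → Cube n → ℕ
weight []          = 0
weight (false ∷ v) = weight v
weight (true ∷ v)  = suc (weight v)

_==_ : ∀ {n} → Cube n → Cube n → Bool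
[]          == []          = true
(false ∷ v) == (false ∷ w) = v == w
(false ∷ v) == (true ∷ w)  = false
(true ∷ v)  == (false ∷ w) = false
(true ∷ v)  == (true ∷ w)  = v == w

_≼_ : ∀ {n} → Cube n → Cube n → Bool
[]          ≼ []          = true
(false ∷ v) ≼ (_ ∷ w)     = v ≼ w
(true ∷ v)  ≼ (false ∷ w) = false
(true ∷ v)  ≼ (true ∷ w)  = v ≼ w

-- The covering relation, given recursively so that sums over covers split along the first
-- coordinate; `≼∧weight⇒⋖` recovers it from order and weight.
_⋖_ : ∀ {n} → Cube n → Cube n → Bool
[]          ⋖ []          = false
(false ∷ v) ⋖ (false ∷ w) = v ⋖ w
(false ∷ v) ⋖ (true ∷ w)  = v == w
(true ∷ v)  ⋖ (false ∷ w) = false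
(true ∷ v)  ⋖ (true ∷ w)  = v ⋖ w

==-refl : ∀ {n} (v : Cube n) → v == v ≡ true
==-refl []          = refl
==-refl (false ∷ v) = ==-refl v
==-refl (true ∷ v)  = ==-refl v

==⇒≡ : ∀ {n} (v w : Cube n) → v == w ≡ true → v ≡ w
==⇒≡ []          []          _  = refl
==⇒≡ (false ∷ v) (false ∷ w) eq = cong (false ∷_) (==⇒≡ v w eq)
==⇒≡ (true ∷ v)  (true ∷ w)  eq = cong (true ∷_) (==⇒≡ v w eq)

≼-refl : ∀ {n} (v : Cube n) → v ≼ v ≡ true
≼-refl []          = refl
≼-refl (false ∷ v) = ≼-refl v
≼-refl (true ∷ v)  = ≼-refl v

≼⇒weight≤ : ∀ {n} (v w : Cube n) → v ≼ w ≡ true → weight v ≤ weight w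
≼⇒weight≤ []          []          _ = ℕ.z≤n
≼⇒weight≤ (false ∷ v) (false ∷ w) p = ≼⇒weight≤ v w p
≼⇒weight≤ (false ∷ v) (true ∷ w)  p = ℕ.m≤n⇒m≤1+n (≼⇒weight≤ v w p)
≼⇒weight≤ (true ∷ v)  (true ∷ w)  p = ℕ.s≤s (≼⇒weight≤ v w p)

≼∧weight≡⇒≡ : ∀ {n} (v w : Cube n) → v ≼ w ≡ true → weight v ≡ weight w → v ≡ w
≼∧weight≡⇒≡ []          []          _ _  = refl
≼∧weight≡⇒≡ (false ∷ v) (false ∷ w) p eq = cong (false ∷_) (≼∧weight≡⇒≡ v w p eq)
≼∧weight≡⇒≡ (false ∷ v) (true ∷ w)  p eq = ⊥-elim (ℕ.<-irrefl eq (ℕ.s≤s (≼⇒weight≤ v w p)))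
≼∧weight≡⇒≡ (true ∷ v)  (true ∷ w)  p eq = cong (true ∷_) (≼∧weight≡⇒≡ v w p (ℕ.suc-injective eq))

⋖⇒≼ : ∀ {n} (v w : Cube n) → v ⋖ w ≡ true → v ≼ w ≡ true
⋖⇒≼ []          []          ()
⋖⇒≼ (false ∷ v) (false ∷ w) p = ⋖⇒≼ v w p
⋖⇒≼ (false ∷ v) (true ∷ w)  p rewrite ==⇒≡ v w p = ≼-refl w
⋖⇒≼ (true ∷ v)  (true ∷ w)  p = ⋖⇒≼ v w p

⋖⇒weight : ∀ {n} (v w : Cube n) → v ⋖ w ≡ true → weight w ≡ suc (weight v)
⋖⇒weight []          []          ()
⋖⇒weight (false ∷ v) (false ∷ w) p = ⋖⇒weight v w p
⋖⇒weight (false ∷ v) (true ∷ w)  p rewrite ==⇒≡ v w p = refl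
⋖⇒weight (true ∷ v)  (true ∷ w)  p = cong suc (⋖⇒weight v w p)

≼∧weight⇒⋖ : ∀ {n} (v w : Cube n) → v ≼ w ≡ true → weight w ≡ suc (weight v) → v ⋖ w ≡ true
≼∧weight⇒⋖ (false ∷ v) (false ∷ w) p eq = ≼∧weight⇒⋖ v w p eq
≼∧weight⇒⋖ (false ∷ v) (true ∷ w)  p eq
  rewrite ≼∧weight≡⇒≡ v w p (≡.sym (ℕ.suc-injective eq)) = ==-refl w
≼∧weight⇒⋖ (true ∷ v)  (true ∷ w)  p eq = ≼∧weight⇒⋖ v w p (ℕ.suc-injective eq)

∑ᵛ-δ : ∀ {n} (v : Cube n) (f : Cube n → ℤ) → ∑ᵛ (λ w → ⟦ v == w ⟧ * f w) ≡ f v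
∑ᵛ-δ []          f = ℤ.*-identityˡ (f [])
∑ᵛ-δ {suc n} (false ∷ v) f = trans (cong₂ _+_ (∑ᵛ-δ v (λ w → f (false ∷ w))) (∑ᵛ-0 n)) (ℤ.+-identityʳ _)
∑ᵛ-δ {suc n} (true ∷ v)  f = trans (cong₂ _+_ (∑ᵛ-0 n) (∑ᵛ-δ v (λ w → f (true ∷ w)))) (ℤ.+-identityˡ _)

==-sym : ∀ {n} (v w : Cube n) → v == w ≡ w == v
==-sym v w = Bool.⇔→≡ {z = true} (mk⇔ (flip v w) (flip w v))
  where flip : ∀ v w → v == w ≡ true → w == v ≡ true
        flip v w p rewrite ==⇒≡ v w p = ==-refl w

-- Writing `f (to v)` as a sum against a delta function reduces the change of variables to
-- exchanging two sums, because `to v == w` and `from w == v` agree.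
∑ᵛ-reindex : ∀ {n} (to from : Cube n → Cube n) →
  (∀ v → from (to v) ≡ v) → (∀ v → to (from v) ≡ v) →
  (f : Cube n → ℤ) → ∑ᵛ (λ v → f (to v)) ≡ ∑ᵛ f
∑ᵛ-reindex to from from∘to to∘from f = begin
  ∑ᵛ (λ v → f (to v))                            ≡⟨ ∑ᵛ-cong (λ v → ∑ᵛ-δ (to v) f) ⟨
  ∑ᵛ (λ v → ∑ᵛ (λ w → ⟦ to v == w ⟧ * f w))      ≡⟨ ∑ᵛ-swap (λ v w → ⟦ to v == w ⟧ * f w) ⟩
  ∑ᵛ (λ w → ∑ᵛ (λ v → ⟦ to v == w ⟧ * f w))      ≡⟨ ∑ᵛ-cong (λ w → ∑ᵛ-cong (λ v → cong (λ b → ⟦ b ⟧ * f w) (adjoint v w))) ⟩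
  ∑ᵛ (λ w → ∑ᵛ (λ v → ⟦ from w == v ⟧ * f w))    ≡⟨ ∑ᵛ-cong (λ w → ∑ᵛ-δ (from w) (λ _ → f w)) ⟩
  ∑ᵛ f                                           ∎
  where
  adjoint : ∀ v w → to v == w ≡ from w == v
  adjoint v w = Bool.⇔→≡ {z = true} (mk⇔
    (λ p → ≡.subst (λ z → from z == v ≡ true) (==⇒≡ (to v) w p)
             (≡.subst (λ z → z == v ≡ true) (≡.sym (from∘to v)) (==-refl v)))
    (λ p → ≡.subst (λ z → to z == w ≡ true) (==⇒≡ (from w) v p)
             (≡.subst (λ z → z == w ≡ true) (≡.sym (to∘from w)) (==-refl w))))

-- The operators D (`down`) and U (`up`)

down up : ∀ {n} → (Cube n → ℤ) → Cube n → ℤ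
down f v = ∑ᵛ (λ w → ⟦ v ⋖ w ⟧ * f w)
up   f w = ∑ᵛ (λ v → ⟦ v ⋖ w ⟧ * f v)

-- An upper cover of `false ∷ v` is `true ∷ v` or has first bit false and a tail covering `v`. This
-- and the next three formulas drive the induction for `norm-identity`.
down-false : ∀ {n} (f : Cube (suc n) → ℤ) v →
  down f (false ∷ v) ≡ down (λ w → f (false ∷ w)) v + f (true ∷ v)
down-false f v = cong (_+_ (down (λ w → f (false ∷ w)) v)) (∑ᵛ-δ v (λ w → f (true ∷ w)))

down-true : ∀ {n} (f : Cube (suc n) → ℤ) v → down f (true ∷ v) ≡ down (λ w → f (true ∷ w)) v
down-true {n} f v = trans (cong (λ z → z + down (λ w → f (true ∷ w)) v) (∑ᵛ-0 n)) (ℤ.+-identityˡ _)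

up-false : ∀ {n} (f : Cube (suc n) → ℤ) w → up f (false ∷ w) ≡ up (λ v → f (false ∷ v)) w
up-false {n} f w = trans (cong (_+_ (up (λ v → f (false ∷ v)) w)) (∑ᵛ-0 n)) (ℤ.+-identityʳ _)

up-true : ∀ {n} (f : Cube (suc n) → ℤ) w →
  up f (true ∷ w) ≡ f (false ∷ w) + up (λ v → f (true ∷ v)) w
up-true f w = cong (λ z → z + up (λ v → f (true ∷ v)) w) (trans
  (∑ᵛ-cong (λ v → cong (λ b → ⟦ b ⟧ * f (false ∷ v)) (==-sym v w)))
  (∑ᵛ-δ w (λ v → f (false ∷ v))))

-- Both sides sum `g v * f w` over all covering pairs.
down-up-adjoint : ∀ {n} (f g : Cube n → ℤ) → ∑ᵛ (λ v → g v * down f v) ≡ ∑ᵛ (λ w → f w * up g w)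
down-up-adjoint f g = begin
  ∑ᵛ (λ v → g v * down f v)                        ≡⟨ ∑ᵛ-cong (λ v → ∑ᵛ-*ˡ (g v) (λ w → ⟦ v ⋖ w ⟧ * f w)) ⟨
  ∑ᵛ (λ v → ∑ᵛ (λ w → g v * (⟦ v ⋖ w ⟧ * f w)))    ≡⟨ ∑ᵛ-swap (λ v w → g v * (⟦ v ⋖ w ⟧ * f w)) ⟩
  ∑ᵛ (λ w → ∑ᵛ (λ v → g v * (⟦ v ⋖ w ⟧ * f w)))    ≡⟨ ∑ᵛ-cong (λ w → ∑ᵛ-cong (λ v → lemma (g v) ⟦ v ⋖ w ⟧ (f w))) ⟩
  ∑ᵛ (λ w → ∑ᵛ (λ v → f w * (⟦ v ⋖ w ⟧ * g v)))    ≡⟨ ∑ᵛ-cong (λ w → ∑ᵛ-*ˡ (f w) (λ v → ⟦ v ⋖ w ⟧ * g v)) ⟩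
  ∑ᵛ (λ w → f w * up g w)                          ∎
  where lemma : ∀ a b c → a * (b * c) ≡ c * (b * a)
        lemma = solve-∀

normSq : ∀ {n} → (Cube n → ℤ) → ℤ
normSq f = ∑ᵛ (λ v → f v * f v)

weightedNormSq : ∀ {n} → (Cube n → ℤ) → ℤ
weightedNormSq f = ∑ᵛ (λ v → + weight v * (f v * f v))

normSq-+ : ∀ {n} (f g : Cube n → ℤ) →
  normSq (λ v → f v + g v) ≡ normSq f + + 2 * ∑ᵛ (λ v → g v * f v) + normSq g
normSq-+ f g = begin
  normSq (λ v → f v + g v)
    ≡⟨ ∑ᵛ-cong (λ v → lemma (f v) (g v)) ⟩
  ∑ᵛ (λ v → f v * f v + + 2 * (g v * f v) + g v * g v)
    ≡⟨ ∑ᵛ-+ (λ v → f v * f v + + 2 * (g v * f v)) (λ v → g v * g v) ⟩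
  ∑ᵛ (λ v → f v * f v + + 2 * (g v * f v)) + normSq g
    ≡⟨ cong (λ z → z + normSq g) (∑ᵛ-+ (λ v → f v * f v) (λ v → + 2 * (g v * f v))) ⟩
  normSq f + ∑ᵛ (λ v → + 2 * (g v * f v)) + normSq g
    ≡⟨ cong (λ z → normSq f + z + normSq g) (∑ᵛ-*ˡ (+ 2) (λ v → g v * f v)) ⟩
  normSq f + + 2 * ∑ᵛ (λ v → g v * f v) + normSq g ∎
  where lemma : ∀ a b → (a + b) * (a + b) ≡ a * a + + 2 * (b * a) + b * b
        lemma = solve-∀

-- The commutation relation of the up and down operators, [down, up] = n − 2 weight, as an identity of norms.
norm-identity : ∀ {n} (f : Cube n → ℤ) →
  normSq (down f) + + n * normSq f ≡ normSq (up f) + + 2 * weightedNormSq f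
norm-identity {zero} f = lemma (f [])
  where lemma : ∀ a → (0ℤ * a) * (0ℤ * a) + 0ℤ * (a * a) ≡ (0ℤ * a) * (0ℤ * a) + + 2 * (0ℤ * (a * a))
        lemma = solve-∀
norm-identity {suc n} f = begin
  normSq (down f) + + suc n * normSq f
    ≡⟨ cong (λ z → z + + suc n * normSq f) (cong₂ _+_ downFalse downTrue) ⟩
  (D₀ + + 2 * P + Q₁) + D₁ + (1ℤ + + n) * (Q₀ + Q₁)
    ≡⟨ rearrange₁ D₀ P Q₁ D₁ (+ n) Q₀ ⟩
  (D₀ + + n * Q₀) + (D₁ + + n * Q₁) + (+ 2 * P + + 2 * Q₁ + Q₀)
    ≡⟨ cong₂ (λ x y → x + y + (+ 2 * P + + 2 * Q₁ + Q₀)) (norm-identity f₀) (norm-identity f₁) ⟩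
  (U₀ + + 2 * W₀) + (U₁ + + 2 * W₁) + (+ 2 * P + + 2 * Q₁ + Q₀)
    -- Splitting `down` and splitting `up` each leave one cross term between the two halves of the
    -- cube; adjointness identifies them.
    ≡⟨ cong (λ p → (U₀ + + 2 * W₀) + (U₁ + + 2 * W₁) + (+ 2 * p + + 2 * Q₁ + Q₀)) P≡P′ ⟩
  (U₀ + + 2 * W₀) + (U₁ + + 2 * W₁) + (+ 2 * P′ + + 2 * Q₁ + Q₀)
    ≡⟨ rearrange₂ U₀ W₀ U₁ W₁ P′ Q₁ Q₀ ⟩
  (U₀ + (Q₀ + + 2 * P′ + U₁)) + + 2 * (W₀ + (Q₁ + W₁))
    ≡⟨ cong₂ (λ x y → x + + 2 * (W₀ + y)) (cong₂ _+_ upFalse upTrue) weightTrue ⟨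
  normSq (up f) + + 2 * weightedNormSq f ∎
  where
  f₀ f₁ : Cube n → ℤ
  f₀ v = f (false ∷ v)
  f₁ v = f (true ∷ v)
  D₀ D₁ U₀ U₁ Q₀ Q₁ W₀ W₁ P P′ : ℤ
  D₀ = normSq (down f₀)
  D₁ = normSq (down f₁)
  U₀ = normSq (up f₀)
  U₁ = normSq (up f₁)
  Q₀ = normSq f₀
  Q₁ = normSq f₁
  W₀ = weightedNormSq f₀
  W₁ = weightedNormSq f₁
  P  = ∑ᵛ (λ v → f₁ v * down f₀ v)
  P′ = ∑ᵛ (λ v → up f₁ v * f₀ v)
  P≡P′ : P ≡ P′
  P≡P′ = trans (down-up-adjoint f₀ f₁) (∑ᵛ-cong (λ v → ℤ.*-comm (f₀ v) (up f₁ v)))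
  downFalse : ∑ᵛ (λ v → down f (false ∷ v) * down f (false ∷ v)) ≡ D₀ + + 2 * P + Q₁
  downFalse = trans (∑ᵛ-cong (λ v → cong₂ _*_ (down-false f v) (down-false f v))) (normSq-+ (down f₀) f₁)
  downTrue : ∑ᵛ (λ v → down f (true ∷ v) * down f (true ∷ v)) ≡ D₁
  downTrue = ∑ᵛ-cong (λ v → cong₂ _*_ (down-true f v) (down-true f v))
  upFalse : ∑ᵛ (λ v → up f (false ∷ v) * up f (false ∷ v)) ≡ U₀
  upFalse = ∑ᵛ-cong (λ v → cong₂ _*_ (up-false f v) (up-false f v))
  upTrue : ∑ᵛ (λ v → up f (true ∷ v) * up f (true ∷ v)) ≡ Q₀ + + 2 * P′ + U₁
  upTrue = trans (∑ᵛ-cong (λ v → cong₂ _*_ (up-true f v) (up-true f v))) (normSq-+ f₀ (up f₁))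
  weightTrue : ∑ᵛ (λ v → + weight (true ∷ v) * (f₁ v * f₁ v)) ≡ Q₁ + W₁
  weightTrue = trans (∑ᵛ-cong (λ v → distrib (+ weight v) (f₁ v * f₁ v)))
                     (∑ᵛ-+ (λ v → f₁ v * f₁ v) (λ v → + weight v * (f₁ v * f₁ v)))
    where distrib : ∀ a x → (1ℤ + a) * x ≡ x + a * x
          distrib = solve-∀
  rearrange₁ : ∀ d₀ p q₁ d₁ n q₀ → (d₀ + + 2 * p + q₁) + d₁ + (1ℤ + n) * (q₀ + q₁) ≡
                           (d₀ + n * q₀) + (d₁ + n * q₁) + (+ 2 * p + + 2 * q₁ + q₀)
  rearrange₁ = solve-∀
  rearrange₂ : ∀ u₀ w₀ u₁ w₁ p q₁ q₀ → (u₀ + + 2 * w₀) + (u₁ + + 2 * w₁) + (+ 2 * p + + 2 * q₁ + q₀) ≡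
                           (u₀ + (q₀ + + 2 * p + u₁)) + + 2 * (w₀ + (q₁ + w₁))
  rearrange₂ = solve-∀

-- Injectivity of the up and down operators

square-nonneg : ∀ i → 0ℤ ℤ.≤ i * i
square-nonneg (+ zero)  = ℤ.≤-refl
square-nonneg (+ suc n) = ℤ.+≤+ ℕ.z≤n
square-nonneg -[1+ n ]  = ℤ.+≤+ ℕ.z≤n

square≡0 : ∀ {i} → i * i ≡ 0ℤ → i ≡ 0ℤ
square≡0 {i} eq with ℤ.i*j≡0⇒i≡0∨j≡0 i eq
... | inj₁ p = p
... | inj₂ p = p

normSq-nonneg : ∀ {n} (f : Cube n → ℤ) → 0ℤ ℤ.≤ normSq f
normSq-nonneg f = ∑ᵛ-nonneg (λ v → square-nonneg (f v))

normSq≡0 : ∀ {n} (f : Cube n → ℤ) → normSq f ≡ 0ℤ → ∀ v → f v ≡ 0ℤ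
normSq≡0 f eq v = square≡0 (∑ᵛ≡0⇒≡0 (λ v → square-nonneg (f v)) eq v)

⟦⟧-*-zero : ∀ b {x} → (b ≡ true → x ≡ 0ℤ) → ⟦ b ⟧ * x ≡ 0ℤ
⟦⟧-*-zero true  x≡0 = trans (ℤ.*-identityˡ _) (x≡0 refl)
⟦⟧-*-zero false x≡0 = refl

⟦⟧-*-cong : ∀ b {x y} → (b ≡ true → x ≡ y) → ⟦ b ⟧ * x ≡ ⟦ b ⟧ * y
⟦⟧-*-cong true  x≡y = cong (_*_ 1ℤ) (x≡y refl)
⟦⟧-*-cong false x≡y = refl

≡ᵇ-refl : ∀ n → (n ℕ.≡ᵇ n) ≡ true
≡ᵇ-refl zero    = refl
≡ᵇ-refl (suc n) = ≡ᵇ-refl n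

≡ᵇ⇒≡ : ∀ m n → (m ℕ.≡ᵇ n) ≡ true → m ≡ n
≡ᵇ⇒≡ zero    zero    _ = refl
≡ᵇ⇒≡ (suc m) (suc n) p = cong suc (≡ᵇ⇒≡ m n p)

-- On a function supported on one level the weighted norm of `norm-identity` is a multiple of the
-- plain norm, so the identity compares only three norms.
level : ∀ {n} → ℕ → (Cube n → ℤ) → Cube n → ℤ
level d f v = ⟦ weight v ℕ.≡ᵇ d ⟧ * f v

level-at : ∀ {n} d (f : Cube n → ℤ) v → weight v ≡ d → level d f v ≡ f v
level-at d f v refl rewrite ≡ᵇ-refl (weight v) = ℤ.*-identityˡ (f v)

exchange : ∀ a b c → a * (b * c) ≡ b * (a * c)
exchange = solve-∀

-- All covers of `v` have weight one more than `v`, so the level indicator is constant in the sum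
-- and factors out.
down-level : ∀ {n} d (f : Cube n → ℤ) v →
  down (level d f) v ≡ ⟦ suc (weight v) ℕ.≡ᵇ d ⟧ * down f v
down-level d f v = trans
  (∑ᵛ-cong (λ w → trans
    (⟦⟧-*-cong (v ⋖ w) (λ p → cong (λ k → ⟦ k ℕ.≡ᵇ d ⟧ * f w) (⋖⇒weight v w p)))
    (exchange ⟦ v ⋖ w ⟧ ⟦ suc (weight v) ℕ.≡ᵇ d ⟧ (f w))))
  (∑ᵛ-*ˡ ⟦ suc (weight v) ℕ.≡ᵇ d ⟧ (λ w → ⟦ v ⋖ w ⟧ * f w))

up-level : ∀ {n} d (f : Cube n → ℤ) w →
  up (level d f) w ≡ ⟦ weight w ℕ.≡ᵇ suc d ⟧ * up f w
up-level d f w = trans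
  (∑ᵛ-cong (λ v → trans
    (⟦⟧-*-cong (v ⋖ w) (λ p → cong (λ k → ⟦ k ℕ.≡ᵇ suc d ⟧ * f v) (≡.sym (⋖⇒weight v w p))))
    (exchange ⟦ v ⋖ w ⟧ ⟦ weight w ℕ.≡ᵇ suc d ⟧ (f v))))
  (∑ᵛ-*ˡ ⟦ weight w ℕ.≡ᵇ suc d ⟧ (λ v → ⟦ v ⋖ w ⟧ * f v))

weightedNormSq-level : ∀ {n} d (f : Cube n → ℤ) →
  weightedNormSq (level d f) ≡ + d * normSq (level d f)
weightedNormSq-level d f = trans
  (∑ᵛ-cong (λ v → lemma v (weight v ℕ.≡ᵇ d) refl))
  (∑ᵛ-*ˡ (+ d) (λ v → level d f v * level d f v))
  where
  lemma : ∀ v b → (weight v ℕ.≡ᵇ d) ≡ b →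
    + weight v * ((⟦ b ⟧ * f v) * (⟦ b ⟧ * f v)) ≡ + d * ((⟦ b ⟧ * f v) * (⟦ b ⟧ * f v))
  lemma v true  eq = cong (λ k → + k * ((1ℤ * f v) * (1ℤ * f v))) (≡ᵇ⇒≡ (weight v) d eq)
  lemma v false eq = trans (ℤ.*-zeroʳ (+ weight v)) (≡.sym (ℤ.*-zeroʳ (+ d)))

level-norm-identity : ∀ {n} d (f : Cube n → ℤ) →
  normSq (down (level d f)) + + n * normSq (level d f) ≡
  normSq (up (level d f)) + + (2 ℕ.* d) * normSq (level d f)
level-norm-identity d f = trans (norm-identity (level d f)) (cong (_+_ (normSq (up (level d f)))) (begin
  + 2 * weightedNormSq (level d f)      ≡⟨ cong (_*_ (+ 2)) (weightedNormSq-level d f) ⟩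
  + 2 * (+ d * normSq (level d f))      ≡⟨ ℤ.*-assoc (+ 2) (+ d) (normSq (level d f)) ⟨
  + 2 * + d * normSq (level d f)        ≡⟨ cong (λ z → z * normSq (level d f)) (ℤ.pos-* 2 d) ⟨
  + (2 ℕ.* d) * normSq (level d f)      ∎))

-- A positive `s` would give m s < k s ≤ u + k s. Both injectivity results extract a vanishing norm
-- in this way.
smaller-multiple : ∀ {m k s u} → m ℕ.< k → 0ℤ ℤ.≤ s → 0ℤ ℤ.≤ u →
  + m * s ≡ u + + k * s → s ≡ 0ℤ
smaller-multiple {m} {k} {+ zero}  {u}   m<k _ _ eq = refl
smaller-multiple {m} {k} {+ suc s} {+ u} m<k _ _ eq = ⊥-elim (ℕ.<-irrefl m*s≡u+k*s
  (ℕ.<-≤-trans (ℕ.*-monoˡ-< (suc s) m<k) (ℕ.m≤n+m (k ℕ.* suc s) u)))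
  where
  m*s≡u+k*s : m ℕ.* suc s ≡ u ℕ.+ k ℕ.* suc s
  m*s≡u+k*s = ℤ.+-injective (begin
    + (m ℕ.* suc s)          ≡⟨ ℤ.pos-* m (suc s) ⟩
    + m * + suc s            ≡⟨ eq ⟩
    + u + + k * + suc s      ≡⟨ cong (_+_ (+ u)) (ℤ.pos-* k (suc s)) ⟨
    + (u ℕ.+ k ℕ.* suc s)    ∎)

VanishesAt : ∀ {n} → ℕ → (Cube n → ℤ) → Set
VanishesAt d f = ∀ v → weight v ≡ d → f v ≡ 0ℤ

level-normSq≡0 : ∀ {n} d (f : Cube n → ℤ) → normSq (level d f) ≡ 0ℤ → VanishesAt d f
level-normSq≡0 d f eq v wt = trans (≡.sym (level-at d f v wt)) (normSq≡0 (level d f) eq v)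

-- For the part of `f` on level d + 1 the norm of `down` is zero, and the identity becomes n |f|² =
-- |Uf|² + 2(d + 1) |f|².
down-injective : ∀ {n} d (f : Cube n → ℤ) → n ℕ.< 2 ℕ.* suc d →
  VanishesAt d (down f) → VanishesAt (suc d) f
down-injective {n} d f n<2d down≡0 = level-normSq≡0 (suc d) f (smaller-multiple n<2d
  (normSq-nonneg (level (suc d) f)) (normSq-nonneg (up (level (suc d) f))) (begin
    + n * normSq (level (suc d) f)
      ≡⟨ ℤ.+-identityˡ _ ⟨
    0ℤ + + n * normSq (level (suc d) f)
      ≡⟨ cong (λ z → z + + n * normSq (level (suc d) f)) (∑ᵛ-zero (λ v → cong (λ z → z * z) (trans
           (down-level (suc d) f v)
           (⟦⟧-*-zero (weight v ℕ.≡ᵇ d) (λ p → down≡0 v (≡ᵇ⇒≡ (weight v) d p)))))) ⟨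
    normSq (down (level (suc d) f)) + + n * normSq (level (suc d) f)
      ≡⟨ level-norm-identity (suc d) f ⟩
    normSq (up (level (suc d) f)) + + (2 ℕ.* suc d) * normSq (level (suc d) f) ∎))

-- Here the norm of `up` is zero and the identity, read backwards, becomes 2d |f|² = |Df|² + n |f|².
up-injective : ∀ {n} d (f : Cube n → ℤ) → 2 ℕ.* d ℕ.< n →
  VanishesAt (suc d) (up f) → VanishesAt d f
up-injective {n} d f 2d<n up≡0 = level-normSq≡0 d f (smaller-multiple 2d<n
  (normSq-nonneg (level d f)) (normSq-nonneg (down (level d f))) (begin
    + (2 ℕ.* d) * normSq (level d f)
      ≡⟨ ℤ.+-identityˡ _ ⟨
    0ℤ + + (2 ℕ.* d) * normSq (level d f)
      ≡⟨ cong (λ z → z + + (2 ℕ.* d) * normSq (level d f)) (∑ᵛ-zero (λ v → cong (λ z → z * z) (trans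
           (up-level d f v)
           (⟦⟧-*-zero (weight v ℕ.≡ᵇ suc d) (λ p → up≡0 v (≡ᵇ⇒≡ (weight v) (suc d) p)))))) ⟨
    normSq (up (level d f)) + + (2 ℕ.* d) * normSq (level d f)
      ≡⟨ level-norm-identity d f ⟨
    normSq (down (level d f)) + + n * normSq (level d f) ∎))

-- Counting points below a given point

down-0 : ∀ {n} (v : Cube n) → down (λ _ → 0ℤ) v ≡ 0ℤ
down-0 v = ∑ᵛ-zero (λ w → ℤ.*-zeroʳ ⟦ v ⋖ w ⟧)

-- If v lies below x, each edge of x missing from v yields one cover of v below x; otherwise no
-- cover of v lies below x.
down-≼ : ∀ {n} (x v : Cube n) →
  down (λ w → ⟦ w ≼ x ⟧) v ≡ (+ weight x - + weight v) * ⟦ v ≼ x ⟧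
down-≼ [] [] = refl
down-≼ (false ∷ x) (false ∷ v) = trans (down-false (λ w → ⟦ w ≼ (false ∷ x) ⟧) v)
  (trans (ℤ.+-identityʳ _) (down-≼ x v))
down-≼ (true ∷ x) (false ∷ v) = trans (down-false (λ w → ⟦ w ≼ (true ∷ x) ⟧) v)
  (trans (cong (λ z → z + ⟦ v ≼ x ⟧) (down-≼ x v)) (lemma (+ weight x) (+ weight v) ⟦ v ≼ x ⟧))
  where lemma : ∀ a b z → (a - b) * z + z ≡ (1ℤ + a - b) * z
        lemma = solve-∀
down-≼ (false ∷ x) (true ∷ v) = trans (down-true (λ w → ⟦ w ≼ (false ∷ x) ⟧) v)
  (trans (down-0 v) (≡.sym (ℤ.*-zeroʳ (+ weight x - + weight (true ∷ v)))))
down-≼ (true ∷ x) (true ∷ v) = trans (down-true (λ w → ⟦ w ≼ (true ∷ x) ⟧) v)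
  (trans (down-≼ x v) (cong (λ z → z * ⟦ v ≼ x ⟧) (lemma (+ weight x) (+ weight v))))
  where lemma : ∀ a b → a - b ≡ (1ℤ + a) - (1ℤ + b)
        lemma = solve-∀

-- Expresses the weight through the order alone, which is how `weight-to` sees that order
-- automorphisms preserve it.
∑ᵛ-below : ∀ {n} (v : Cube n) → ∑ᵛ (λ u → ⟦ u ≼ v ⟧) ≡ + (2 ℕ.^ weight v)
∑ᵛ-below [] = refl
∑ᵛ-below {suc n} (false ∷ v) = trans (cong₂ _+_ (∑ᵛ-below v) (∑ᵛ-0 n)) (ℤ.+-identityʳ _)
∑ᵛ-below (true ∷ v) = trans (cong₂ _+_ (∑ᵛ-below v) (∑ᵛ-below v))
  (cong (λ k → + (2 ℕ.^ weight v ℕ.+ k)) (≡.sym (ℕ.+-identityʳ _)))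

2^-injective : ∀ m n → 2 ℕ.^ m ≡ 2 ℕ.^ n → m ≡ n
2^-injective m n eq with ℕ.<-cmp m n
... | tri< m<n _ _ = ⊥-elim (ℕ.<-irrefl eq (ℕ.^-monoʳ-< 2 (ℕ.s≤s (ℕ.s≤s ℕ.z≤n)) m<n))
... | tri≈ _ m≡n _ = m≡n
... | tri> _ _ n<m = ⊥-elim (ℕ.<-irrefl (≡.sym eq) (ℕ.^-monoʳ-< 2 (ℕ.s≤s (ℕ.s≤s ℕ.z≤n)) n<m))

-- Order automorphisms of the cube

record Automorphism (n : ℕ) : Set where
  field
    to from : Cube n → Cube n
    from∘to : ∀ v → from (to v) ≡ v
    to∘from : ∀ v → to (from v) ≡ v
    to-mono : ∀ v w → v ≼ w ≡ true → to v ≼ to w ≡ true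
    from-mono : ∀ v w → v ≼ w ≡ true → from v ≼ from w ≡ true

  to-≼ : ∀ v w → to v ≼ to w ≡ v ≼ w
  to-≼ v w = Bool.⇔→≡ {z = true} (mk⇔
    (λ p → ≡.subst₂ (λ x y → x ≼ y ≡ true) (from∘to v) (from∘to w) (from-mono (to v) (to w) p))
    (to-mono v w))

  ∑ᵛ-to : (f : Cube n → ℤ) → ∑ᵛ (λ v → f (to v)) ≡ ∑ᵛ f
  ∑ᵛ-to = ∑ᵛ-reindex to from from∘to to∘from

  weight-to : ∀ v → weight (to v) ≡ weight v
  weight-to v = 2^-injective _ _ (ℤ.+-injective (begin
    + (2 ℕ.^ weight (to v))          ≡⟨ ∑ᵛ-below (to v) ⟨
    ∑ᵛ (λ u → ⟦ u ≼ to v ⟧)          ≡⟨ ∑ᵛ-to (λ u → ⟦ u ≼ to v ⟧) ⟨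
    ∑ᵛ (λ u → ⟦ to u ≼ to v ⟧)       ≡⟨ ∑ᵛ-cong (λ u → cong ⟦_⟧ (to-≼ u v)) ⟩
    ∑ᵛ (λ u → ⟦ u ≼ v ⟧)             ≡⟨ ∑ᵛ-below v ⟩
    + (2 ℕ.^ weight v)               ∎))

  to-⋖ : ∀ v w → to v ⋖ to w ≡ v ⋖ w
  to-⋖ v w = Bool.⇔→≡ {z = true} (mk⇔
    (λ p → ≼∧weight⇒⋖ v w (trans (≡.sym (to-≼ v w)) (⋖⇒≼ (to v) (to w) p))
      (trans (≡.sym (weight-to w)) (trans (⋖⇒weight (to v) (to w) p) (cong suc (weight-to v)))))
    (λ p → ≼∧weight⇒⋖ (to v) (to w) (trans (to-≼ v w) (⋖⇒≼ v w p))
      (trans (weight-to w) (trans (⋖⇒weight v w p) (cong suc (≡.sym (weight-to v)))))))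

-- Counting up to isomorphism

sum-only : ∀ {n} (f : Fin n → ℤ) i → (∀ j → j ≢ i → f j ≡ 0ℤ) → sum f ≡ f i
sum-only f zero    f≡0 = trans (cong (_+_ (f zero)) (sum-zero (λ j → f≡0 (suc j) (λ ())))) (ℤ.+-identityʳ (f zero))
sum-only f (suc i) f≡0 = trans (cong₂ _+_ (f≡0 zero (λ ()))
  (sum-only (λ j → f (suc j)) i (λ j j≢i → f≡0 (suc j) (j≢i ∘ Fin.suc-injective)))) (ℤ.+-identityˡ (f (suc i)))

sum-∑ᵛ-linear : ∀ {m n} (a : Cube n → ℤ) (X : Fin m → Cube n → ℤ) (u : Fin m → ℤ) →
  sum (λ c → ∑ᵛ (λ v → a v * X c v) * u c) ≡ ∑ᵛ (λ v → a v * sum (λ c → X c v * u c))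
sum-∑ᵛ-linear a X u = begin
  sum (λ c → ∑ᵛ (λ v → a v * X c v) * u c)      ≡⟨ sum-cong-≗ (λ c → ∑ᵛ-*ʳ (u c) (λ v → a v * X c v)) ⟨
  sum (λ c → ∑ᵛ (λ v → a v * X c v * u c))      ≡⟨ sum-∑ᵛ-swap (λ c v → a v * X c v * u c) ⟩
  ∑ᵛ (λ v → sum (λ c → a v * X c v * u c))      ≡⟨ ∑ᵛ-cong (λ v → sum-cong-≗ (λ c → ℤ.*-assoc (a v) (X c v) (u c))) ⟩
  ∑ᵛ (λ v → sum (λ c → a v * (X c v * u c)))    ≡⟨ ∑ᵛ-cong (λ v → *-distribˡ-sum (a v) (λ c → X c v * u c)) ⟨
  ∑ᵛ (λ v → a v * sum (λ c → X c v * u c))      ∎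

cubes : ∀ n → List (Cube n)
cubes zero    = [] ∷ []
cubes (suc n) = map (false ∷_) (cubes n) ++ map (true ∷_) (cubes n)

∈-cubes : ∀ {n} (v : Cube n) → v ∈ cubes n
∈-cubes []          = here refl
∈-cubes (false ∷ v) = ∈-++⁺ˡ (∈-map⁺ (false ∷_) (∈-cubes v))
∈-cubes {suc n} (true ∷ v) = ∈-++⁺ʳ (map (false ∷_) (cubes n)) (∈-map⁺ (true ∷_) (∈-cubes v))

AllPairs-lookup-injective : ∀ {A : Set} {_≈_ : A → A → Set} → (∀ {a b} → a ≈ b → b ≈ a) →
  ∀ {xs} → AllPairs (λ a b → ¬ (a ≈ b)) xs → ∀ i j → lookup xs i ≈ lookup xs j → i ≡ j
AllPairs-lookup-injective symm (_ ∷ _)      zero    zero    _ = refl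
AllPairs-lookup-injective symm (x≉xs ∷ _)   zero    (suc j) p = ⊥-elim (All.lookup x≉xs (∈-lookup j) p)
AllPairs-lookup-injective symm (x≉xs ∷ _)   (suc i) zero    p = ⊥-elim (All.lookup x≉xs (∈-lookup i) (symm p))
AllPairs-lookup-injective symm (_ ∷ unique) (suc i) (suc j) p = cong suc (AllPairs-lookup-injective symm unique i j p)

weight≡0⇒≼ : ∀ {n} (v w : Cube n) → weight v ≡ 0 → v ≼ w ≡ true
weight≡0⇒≼ []          []      _  = refl
weight≡0⇒≼ (false ∷ v) (_ ∷ w) eq = weight≡0⇒≼ v w eq

weight-replicate-false : ∀ n → weight (replicate n false) ≡ 0
weight-replicate-false zero    = refl
weight-replicate-false (suc n) = weight-replicate-false n

weight≡1⇒full : ∀ {n} → n ≤ 1 → ∀ v → weight v ≡ 1 → v ≡ replicate n true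
weight≡1⇒full ℕ.z≤n          []          ()
weight≡1⇒full (ℕ.s≤s ℕ.z≤n) (false ∷ []) ()
weight≡1⇒full (ℕ.s≤s ℕ.z≤n) (true ∷ [])  _ = refl

Any⇒length>0 : ∀ {A : Set} {P : A → Set} {xs} → Any P xs → 0 ℕ.< length xs
Any⇒length>0 (here _)  = ℕ.s≤s ℕ.z≤n
Any⇒length>0 (there _) = ℕ.s≤s ℕ.z≤n

⟦⟧-nonneg : ∀ b → 0ℤ ℤ.≤ ⟦ b ⟧
⟦⟧-nonneg true  = ℤ.+≤+ ℕ.z≤n
⟦⟧-nonneg false = ℤ.≤-refl

⟦⟧-*-nonneg : ∀ b c → 0ℤ ℤ.≤ ⟦ b ⟧ * ⟦ c ⟧
⟦⟧-*-nonneg true  true  = ℤ.+≤+ ℕ.z≤n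
⟦⟧-*-nonneg true  false = ℤ.≤-refl
⟦⟧-*-nonneg false _     = ℤ.≤-refl

*-nonzero : ∀ {a b} → a ≢ 0ℤ → b ≢ 0ℤ → a * b ≢ 0ℤ
*-nonzero a≢0 b≢0 eq = b≢0 (*-nonzero-cancel a≢0 eq)

n<2[1+n/2] : ∀ n → n ℕ.< 2 ℕ.* suc ⌊ n /2⌋
n<2[1+n/2] zero          = ℕ.s≤s ℕ.z≤n
n<2[1+n/2] (suc zero)    = ℕ.s≤s (ℕ.s≤s ℕ.z≤n)
n<2[1+n/2] (suc (suc n)) = ≡.subst (suc (suc n) ℕ.<_) (≡.sym (ℕ.*-suc 2 (suc ⌊ n /2⌋)))
  (ℕ.s≤s (ℕ.s≤s (n<2[1+n/2] n)))

2[n/2]≤n : ∀ n → 2 ℕ.* ⌊ n /2⌋ ≤ n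
2[n/2]≤n zero          = ℕ.z≤n
2[n/2]≤n (suc zero)    = ℕ.z≤n
2[n/2]≤n (suc (suc n)) = ≡.subst (_≤ suc (suc n)) (≡.sym (ℕ.*-suc 2 ⌊ n /2⌋))
  (ℕ.s≤s (ℕ.s≤s (2[n/2]≤n n)))

2*pred[n/2]≤pred : ∀ n → 2 ℕ.* ℕ.pred ⌊ n /2⌋ ≤ ℕ.pred n
2*pred[n/2]≤pred zero          = ℕ.z≤n
2*pred[n/2]≤pred (suc zero)    = ℕ.z≤n
2*pred[n/2]≤pred (suc (suc n)) = ℕ.m≤n⇒m≤1+n (2[n/2]≤n n)

n≤1+pred[n] : ∀ n → n ≤ suc (ℕ.pred n)
n≤1+pred[n] zero    = ℕ.z≤n
n≤1+pred[n] (suc n) = ℕ.≤-refl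

-- The properties of graph isomorphism that the argument relies on: it is a decidable equivalence,
-- and equivalent points are related by an automorphism of the cube that maps every class to itself.
module Orbits {N : ℕ} (_≈_ : Cube N → Cube N → Set) (_≈?_ : ∀ v w → Dec (v ≈ w))
  (isEquivalence : IsEquivalence _≈_)
  (transport : ∀ {v w} → v ≈ w → Σ (Automorphism N) λ τ →
     Automorphism.to τ v ≡ w × (∀ z → z ≈ Automorphism.to τ z)) where

  open IsEquivalence isEquivalence using () renaming (refl to ≈-refl; sym to ≈-sym; trans to ≈-trans)
  open Automorphism

  infix 4 _≈ᵇ_
  _≈ᵇ_ : Cube N → Cube N → Bool
  v ≈ᵇ w = does (v ≈? w)

  ≈ᵇ⇒≈ : ∀ {v w} → (v ≈ᵇ w) ≡ true → v ≈ w
  ≈ᵇ⇒≈ {v} {w} p with v ≈? w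
  ... | yes v≈w = v≈w

  ≈ᵇ-congˡ : ∀ {v v′} w → v ≈ v′ → (v ≈ᵇ w) ≡ (v′ ≈ᵇ w)
  ≈ᵇ-congˡ {v} {v′} w p = does-⇔ (mk⇔ (≈-trans (≈-sym p)) (≈-trans p)) (v ≈? w) (v′ ≈? w)

  ≈⇒weight≡ : ∀ {v w} → v ≈ w → weight v ≡ weight w
  ≈⇒weight≡ {v} p with transport p
  ... | τ , refl , _ = ≡.sym (weight-to τ v)

  orb : Cube N → ℤ
  orb x = ∑ᵛ (λ y → ⟦ y ≈ᵇ x ⟧)

  -- `above g x` is the number K(g) of labelled copies of x containing g, and `below g x` is
  -- I(g)(x).
  above below : Cube N → Cube N → ℤ
  above g x = ∑ᵛ (λ y → ⟦ y ≈ᵇ x ⟧ * ⟦ g ≼ y ⟧)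
  below g x = ∑ᵛ (λ z → ⟦ z ≈ᵇ g ⟧ * ⟦ z ≼ x ⟧)

  -- An automorphism taking `g` to `g′` permutes the copies of `x` and carries those above `g` to
  -- those above `g′`.
  above-cong : ∀ {g g′} x → g ≈ g′ → above g x ≡ above g′ x
  above-cong {g} x p with transport p
  ... | τ , refl , z≈τz = begin
    ∑ᵛ (λ y → ⟦ y ≈ᵇ x ⟧ * ⟦ g ≼ y ⟧)
      ≡⟨ ∑ᵛ-cong (λ y → cong₂ (λ b c → ⟦ b ⟧ * ⟦ c ⟧) (≈ᵇ-congˡ x (≈-sym (z≈τz y))) (to-≼ τ g y)) ⟨
    ∑ᵛ (λ y → ⟦ to τ y ≈ᵇ x ⟧ * ⟦ to τ g ≼ to τ y ⟧)
      ≡⟨ ∑ᵛ-to τ (λ y → ⟦ y ≈ᵇ x ⟧ * ⟦ to τ g ≼ y ⟧) ⟩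
    ∑ᵛ (λ y → ⟦ y ≈ᵇ x ⟧ * ⟦ to τ g ≼ y ⟧) ∎

  below-cong : ∀ g {x x′} → x ≈ x′ → below g x ≡ below g x′
  below-cong g {x} p with transport p
  ... | τ , refl , z≈τz = begin
    ∑ᵛ (λ z → ⟦ z ≈ᵇ g ⟧ * ⟦ z ≼ x ⟧)
      ≡⟨ ∑ᵛ-cong (λ z → cong₂ (λ b c → ⟦ b ⟧ * ⟦ c ⟧) (≈ᵇ-congˡ g (≈-sym (z≈τz z))) (to-≼ τ z x)) ⟨
    ∑ᵛ (λ z → ⟦ to τ z ≈ᵇ g ⟧ * ⟦ to τ z ≼ to τ x ⟧)
      ≡⟨ ∑ᵛ-to τ (λ z → ⟦ z ≈ᵇ g ⟧ * ⟦ z ≼ to τ x ⟧) ⟩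
    ∑ᵛ (λ z → ⟦ z ≈ᵇ g ⟧ * ⟦ z ≼ to τ x ⟧) ∎

  ∑ᵛ-class : ∀ g (f : Cube N → ℤ) → (∀ {z} → z ≈ g → f z ≡ f g) →
    ∑ᵛ (λ z → ⟦ z ≈ᵇ g ⟧ * f z) ≡ orb g * f g
  ∑ᵛ-class g f f-cong = trans
    (∑ᵛ-cong (λ z → ⟦⟧-*-cong (z ≈ᵇ g) (λ p → f-cong (≈ᵇ⇒≈ p))))
    (∑ᵛ-*ʳ (f g) (λ z → ⟦ z ≈ᵇ g ⟧))

  -- Both sides count the pairs z ≼ y with z in the class of `g` and y in the class of `x`, grouped
  -- by z on the left and by y on the right.
  orb-above≡orb-below : ∀ g x → orb g * above g x ≡ orb x * below g x
  orb-above≡orb-below g x = begin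
    orb g * above g x
      ≡⟨ ∑ᵛ-class g (λ z → above z x) (above-cong x) ⟨
    ∑ᵛ (λ z → ⟦ z ≈ᵇ g ⟧ * above z x)
      ≡⟨ ∑ᵛ-cong (λ z → ∑ᵛ-*ˡ ⟦ z ≈ᵇ g ⟧ (λ y → ⟦ y ≈ᵇ x ⟧ * ⟦ z ≼ y ⟧)) ⟨
    ∑ᵛ (λ z → ∑ᵛ (λ y → ⟦ z ≈ᵇ g ⟧ * (⟦ y ≈ᵇ x ⟧ * ⟦ z ≼ y ⟧)))
      ≡⟨ ∑ᵛ-swap (λ z y → ⟦ z ≈ᵇ g ⟧ * (⟦ y ≈ᵇ x ⟧ * ⟦ z ≼ y ⟧)) ⟩
    ∑ᵛ (λ y → ∑ᵛ (λ z → ⟦ z ≈ᵇ g ⟧ * (⟦ y ≈ᵇ x ⟧ * ⟦ z ≼ y ⟧)))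
      ≡⟨ ∑ᵛ-cong (λ y → ∑ᵛ-cong (λ z → exchange ⟦ z ≈ᵇ g ⟧ ⟦ y ≈ᵇ x ⟧ ⟦ z ≼ y ⟧)) ⟩
    ∑ᵛ (λ y → ∑ᵛ (λ z → ⟦ y ≈ᵇ x ⟧ * (⟦ z ≈ᵇ g ⟧ * ⟦ z ≼ y ⟧)))
      ≡⟨ ∑ᵛ-cong (λ y → ∑ᵛ-*ˡ ⟦ y ≈ᵇ x ⟧ (λ z → ⟦ z ≈ᵇ g ⟧ * ⟦ z ≼ y ⟧)) ⟩
    ∑ᵛ (λ y → ⟦ y ≈ᵇ x ⟧ * below g y)
      ≡⟨ ∑ᵛ-class x (below g) (below-cong g) ⟩
    orb x * below g x ∎

  ≈ᵇ-refl : ∀ x → (x ≈ᵇ x) ≡ true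
  ≈ᵇ-refl x = dec-true (x ≈? x) ≈-refl

  orb≢0 : ∀ x → orb x ≢ 0ℤ
  orb≢0 x eq with () ← trans (≡.sym (cong ⟦_⟧ (≈ᵇ-refl x)))
                         (∑ᵛ≡0⇒≡0 (λ y → ⟦⟧-nonneg (y ≈ᵇ x)) eq x)

  above-refl≢0 : ∀ x → above x x ≢ 0ℤ
  above-refl≢0 x eq with () ← trans
    (≡.sym (cong₂ (λ b c → ⟦ b ⟧ * ⟦ c ⟧) (≈ᵇ-refl x) (≼-refl x)))
    (∑ᵛ≡0⇒≡0 (λ y → ⟦⟧-*-nonneg (y ≈ᵇ x) (x ≼ y)) eq x)

  -- Apply `down-≼` to each copy of `x`; all copies have the weight of `x`, so the factor is common
  -- to them.
  down-above : ∀ x v → down (λ g → above g x) v ≡ (+ weight x - + weight v) * above v x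
  down-above x v = begin
    ∑ᵛ (λ w → ⟦ v ⋖ w ⟧ * above w x)
      ≡⟨ ∑ᵛ-cong (λ w → ∑ᵛ-*ˡ ⟦ v ⋖ w ⟧ (λ y → ⟦ y ≈ᵇ x ⟧ * ⟦ w ≼ y ⟧)) ⟨
    ∑ᵛ (λ w → ∑ᵛ (λ y → ⟦ v ⋖ w ⟧ * (⟦ y ≈ᵇ x ⟧ * ⟦ w ≼ y ⟧)))
      ≡⟨ ∑ᵛ-swap (λ w y → ⟦ v ⋖ w ⟧ * (⟦ y ≈ᵇ x ⟧ * ⟦ w ≼ y ⟧)) ⟩
    ∑ᵛ (λ y → ∑ᵛ (λ w → ⟦ v ⋖ w ⟧ * (⟦ y ≈ᵇ x ⟧ * ⟦ w ≼ y ⟧)))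
      ≡⟨ ∑ᵛ-cong (λ y → trans
           (∑ᵛ-cong (λ w → exchange ⟦ v ⋖ w ⟧ ⟦ y ≈ᵇ x ⟧ ⟦ w ≼ y ⟧))
           (∑ᵛ-*ˡ ⟦ y ≈ᵇ x ⟧ (λ w → ⟦ v ⋖ w ⟧ * ⟦ w ≼ y ⟧))) ⟩
    ∑ᵛ (λ y → ⟦ y ≈ᵇ x ⟧ * down (λ w → ⟦ w ≼ y ⟧) v)
      ≡⟨ ∑ᵛ-cong (λ y → ⟦⟧-*-cong (y ≈ᵇ x) (λ p → trans (down-≼ y v)
           (cong (λ k → (+ k - + weight v) * ⟦ v ≼ y ⟧) (≈⇒weight≡ (≈ᵇ⇒≈ p))))) ⟩
    ∑ᵛ (λ y → ⟦ y ≈ᵇ x ⟧ * ((+ weight x - + weight v) * ⟦ v ≼ y ⟧))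
      ≡⟨ ∑ᵛ-cong (λ y → exchange ⟦ y ≈ᵇ x ⟧ (+ weight x - + weight v) ⟦ v ≼ y ⟧) ⟩
    ∑ᵛ (λ y → (+ weight x - + weight v) * (⟦ y ≈ᵇ x ⟧ * ⟦ v ≼ y ⟧))
      ≡⟨ ∑ᵛ-*ˡ (+ weight x - + weight v) (λ y → ⟦ y ≈ᵇ x ⟧ * ⟦ v ≼ y ⟧) ⟩
    (+ weight x - + weight v) * above v x ∎

  above-weight0 : ∀ v x → weight v ≡ 0 → above v x ≡ orb x
  above-weight0 v x wt = ∑ᵛ-cong (λ y → trans
    (cong (λ b → ⟦ y ≈ᵇ x ⟧ * ⟦ b ⟧) (weight≡0⇒≼ v y wt)) (ℤ.*-identityʳ ⟦ y ≈ᵇ x ⟧))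

  Invariant : (Cube N → ℤ) → Set
  Invariant f = ∀ {v w} → v ≈ w → f v ≡ f w

  up-invariant : ∀ {f} → Invariant f → Invariant (up f)
  up-invariant {f} f-inv {w} p with transport p
  ... | τ , refl , z≈τz = begin
    ∑ᵛ (λ v → ⟦ v ⋖ w ⟧ * f v)
      ≡⟨ ∑ᵛ-cong (λ v → cong₂ (λ b z → ⟦ b ⟧ * z) (to-⋖ τ v w) (≡.sym (f-inv (z≈τz v)))) ⟨
    ∑ᵛ (λ v → ⟦ to τ v ⋖ to τ w ⟧ * f (to τ v))
      ≡⟨ ∑ᵛ-to τ (λ v → ⟦ v ⋖ to τ w ⟧ * f v) ⟩
    ∑ᵛ (λ v → ⟦ v ⋖ to τ w ⟧ * f v) ∎

  -- The normalisation makes a multiple of below g x − below g y satisfy the same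
  -- down-equation as an indicator function, although x and y may have orbits of different sizes.
  difference : Cube N → Cube N → Cube N → ℤ
  difference x y g = orb y * above g x - orb x * above g y

  difference-invariant : ∀ x y → Invariant (difference x y)
  difference-invariant x y p =
    cong₂ (λ a b → orb y * a - orb x * b) (above-cong x p) (above-cong y p)

  -- Double counting turns `orb g * difference x y g` into orb x · orb y · (below g x - below g y).
  difference≡0 : ∀ x y g → below g x ≡ below g y → difference x y g ≡ 0ℤ
  difference≡0 x y g eq = *-nonzero-cancel (orb≢0 g) (begin
    orb g * (orb y * above g x - orb x * above g y)
      ≡⟨ lemma₁ (orb g) (orb x) (orb y) (above g x) (above g y) ⟩
    orb y * (orb g * above g x) - orb x * (orb g * above g y)
      ≡⟨ cong₂ (λ a b → orb y * a - orb x * b)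
           (trans (orb-above≡orb-below g x) (cong (_*_ (orb x)) eq)) (orb-above≡orb-below g y) ⟩
    orb y * (orb x * below g y) - orb x * (orb y * below g y)
      ≡⟨ lemma₂ (orb x) (orb y) (below g y) ⟩
    0ℤ ∎)
    where
    lemma₁ : ∀ g x y a b → g * (y * a - x * b) ≡ y * (g * a) - x * (g * b)
    lemma₁ = solve-∀
    lemma₂ : ∀ x y b → y * (x * b) - x * (y * b) ≡ 0ℤ
    lemma₂ = solve-∀

  down-difference : ∀ x y v → down (difference x y) v ≡
    orb y * ((+ weight x - + weight v) * above v x) - orb x * ((+ weight y - + weight v) * above v y)
  down-difference x y v = begin
    down (difference x y) v
      ≡⟨ ∑ᵛ-cong (λ w → lemma ⟦ v ⋖ w ⟧ (orb x) (orb y) (above w x) (above w y)) ⟩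
    ∑ᵛ (λ w → orb y * (⟦ v ⋖ w ⟧ * above w x) + (- orb x) * (⟦ v ⋖ w ⟧ * above w y))
      ≡⟨ ∑ᵛ-+ (λ w → orb y * (⟦ v ⋖ w ⟧ * above w x)) (λ w → (- orb x) * (⟦ v ⋖ w ⟧ * above w y)) ⟩
    ∑ᵛ (λ w → orb y * (⟦ v ⋖ w ⟧ * above w x)) + ∑ᵛ (λ w → (- orb x) * (⟦ v ⋖ w ⟧ * above w y))
      ≡⟨ cong₂ _+_ (∑ᵛ-*ˡ (orb y) (λ w → ⟦ v ⋖ w ⟧ * above w x))
                   (∑ᵛ-*ˡ (- orb x) (λ w → ⟦ v ⋖ w ⟧ * above w y)) ⟩
    orb y * down (λ w → above w x) v + (- orb x) * down (λ w → above w y) v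
      ≡⟨ cong₂ (λ a b → orb y * a + (- orb x) * b) (down-above x v) (down-above y v) ⟩
    orb y * ((+ weight x - + weight v) * above v x) + (- orb x) * ((+ weight y - + weight v) * above v y)
      ≡⟨ cong (_+_ (orb y * ((+ weight x - + weight v) * above v x)))
           (ℤ.neg-distribˡ-* (orb x) ((+ weight y - + weight v) * above v y)) ⟨
    orb y * ((+ weight x - + weight v) * above v x) - orb x * ((+ weight y - + weight v) * above v y) ∎
    where
    lemma : ∀ c x y a b → c * (y * a - x * b) ≡ y * (c * a) + (- x) * (c * b)
    lemma = solve-∀

  difference-at-0 : ∀ x y → VanishesAt 0 (difference x y)
  difference-at-0 x y v wt = trans
    (cong₂ (λ a b → orb y * a - orb x * b) (above-weight0 v x wt) (above-weight0 v y wt))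
    (lemma (orb x) (orb y))
    where
    lemma : ∀ x y → y * x - x * y ≡ 0ℤ
    lemma = solve-∀

  -- At the empty graph, `down (difference x y)` sums the difference over single edges, which gives
  -- zero, yet it also equals orb x · orb y · (|x| - |y|).
  difference-weight : ∀ x y → VanishesAt 1 (difference x y) → weight x ≡ weight y
  difference-weight x y vanishes = ℤ.+-injective (ℤ.i-j≡0⇒i≡j (+ weight x) (+ weight y)
    (*-nonzero-cancel (*-nonzero (orb≢0 x) (orb≢0 y)) (begin
      orb x * orb y * (+ weight x - + weight y)
        ≡⟨ lemma (orb x) (orb y) (+ weight x) (+ weight y) ⟩
      orb y * ((+ weight x - 0ℤ) * orb x) - orb x * ((+ weight y - 0ℤ) * orb y)
        ≡⟨ cong₂ (λ a b → orb y * ((+ weight x - 0ℤ) * a) - orb x * ((+ weight y - 0ℤ) * b))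
             (above-weight0 ∅ x wt∅) (above-weight0 ∅ y wt∅) ⟨
      orb y * ((+ weight x - 0ℤ) * above ∅ x) - orb x * ((+ weight y - 0ℤ) * above ∅ y)
        ≡⟨ cong (λ k → orb y * ((+ weight x - + k) * above ∅ x) - orb x * ((+ weight y - + k) * above ∅ y)) wt∅ ⟨
      orb y * ((+ weight x - + weight ∅) * above ∅ x) - orb x * ((+ weight y - + weight ∅) * above ∅ y)
        ≡⟨ down-difference x y ∅ ⟨
      down (difference x y) ∅
        ≡⟨ ∑ᵛ-zero (λ w → ⟦⟧-*-zero (∅ ⋖ w) (λ p → vanishes w (trans (⋖⇒weight ∅ w p) (cong suc wt∅)))) ⟩
      0ℤ ∎)))
    where
    ∅ : Cube N
    ∅ = replicate N false
    wt∅ = weight-replicate-false N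
    lemma : ∀ x y a b → x * y * (a - b) ≡ y * ((a - 0ℤ) * x) - x * ((b - 0ℤ) * y)
    lemma = solve-∀

  -- The premise on level 1 is there because, for `difference x y`, it supplies the equality of the
  -- two weights.
  DownClosed : (Cube N → ℤ) → Set
  DownClosed f = VanishesAt 1 f → ∀ d → VanishesAt d f → VanishesAt d (down f)

  -- For equal weights the two terms of `down-difference` share their factor, so at each point
  -- `down` multiplies the difference by a number.
  difference-downClosed : ∀ x y → DownClosed (difference x y)
  difference-downClosed x y vanishes₁ d vanishes v wt = begin
    down (difference x y) v
      ≡⟨ down-difference x y v ⟩
    orb y * ((+ weight x - + weight v) * above v x) - orb x * ((+ weight y - + weight v) * above v y)
      ≡⟨ cong (λ k → orb y * ((+ weight x - + weight v) * above v x) - orb x * ((+ k - + weight v) * above v y))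
           (difference-weight x y vanishes₁) ⟨
    orb y * ((+ weight x - + weight v) * above v x) - orb x * ((+ weight x - + weight v) * above v y)
      ≡⟨ lemma (+ weight x - + weight v) (orb x) (orb y) (above v x) (above v y) ⟩
    (+ weight x - + weight v) * difference x y v
      ≡⟨ cong (_*_ (+ weight x - + weight v)) (vanishes v wt) ⟩
    (+ weight x - + weight v) * 0ℤ
      ≡⟨ ℤ.*-zeroʳ (+ weight x - + weight v) ⟩
    0ℤ ∎
    where
    lemma : ∀ c x y a b → y * (c * a) - x * (c * b) ≡ c * (y * a - x * b)
    lemma = solve-∀

  -- If x and y are not equivalent, no copy of y lies above x, since equal weights would make it
  -- equal to x. Only the nonzero term `orb y * above x x` is then left.
  difference-self≡0⇒≈ : ∀ x y → weight x ≡ weight y → difference x y x ≡ 0ℤ → x ≈ y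
  difference-self≡0⇒≈ x y wt eq with x ≈? y
  ... | yes x≈y = x≈y
  ... | no x≉y  = ⊥-elim (*-nonzero (orb≢0 y) (above-refl≢0 x) (begin
    orb y * above x x
      ≡⟨ lemma (orb y * above x x) (orb x) ⟩
    orb y * above x x - orb x * 0ℤ
      ≡⟨ cong (λ z → orb y * above x x - orb x * z) (∑ᵛ-zero (λ z → ⟦⟧-*-zero (z ≈ᵇ y) (absent z))) ⟨
    difference x y x
      ≡⟨ eq ⟩
    0ℤ ∎))
    where
    lemma : ∀ a x → a ≡ a - x * 0ℤ
    lemma = solve-∀
    absent : ∀ z → (z ≈ᵇ y) ≡ true → ⟦ x ≼ z ⟧ ≡ 0ℤ
    absent z p with x ≼ z in x≼z
    ... | false = refl
    ... | true  = ⊥-elim (x≉y (≡.subst (_≈ y)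
      (≡.sym (≼∧weight≡⇒≡ x z x≼z (trans wt (≡.sym (≈⇒weight≡ (≈ᵇ⇒≈ p)))))) (≈ᵇ⇒≈ p)))

  -- Class representatives and the equations between adjacent levels

  decSetoid : DecSetoid _ _
  decSetoid = record { isDecEquivalence = record { isEquivalence = isEquivalence ; _≟_ = _≈?_ } }

  reps : ℕ → List (Cube N)
  reps d = deduplicate _≈?_ (filter (λ v → weight v ℕ.≟ d) (cubes N))

  #reps : ℕ → ℕ
  #reps d = length (reps d)

  rep : ∀ d → Fin (#reps d) → Cube N
  rep d = lookup (reps d)

  weight-rep : ∀ d i → weight (rep d i) ≡ d
  weight-rep d i = All.lookup (All.deduplicate⁺ _≈?_ (All.all-filter (λ v → weight v ℕ.≟ d) (cubes N))) (∈-lookup i)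

  rep-injective : ∀ d i j → rep d i ≈ rep d j → i ≡ j
  rep-injective d = AllPairs-lookup-injective ≈-sym (deduplicate-! decSetoid (filter (λ v → weight v ℕ.≟ d) (cubes N)))

  reps-complete : ∀ v → Any (v ≈_) (reps (weight v))
  reps-complete v = Any.deduplicate⁺ _≈?_ (λ b≈a v≈a → ≈-trans v≈a (≈-sym b≈a))
    (Any.map (λ { refl → ≈-refl }) (∈-filter⁺ (λ w → weight w ℕ.≟ weight v) (∈-cubes v) refl))

  representative : ∀ {d} v → weight v ≡ d → Σ (Fin (#reps d)) λ i → v ≈ rep d i
  representative v refl = Any.index (reps-complete v) , Any.lookup-result (reps-complete v)

  sum-reps : ∀ d v i → v ≈ rep d i → (u : Fin (#reps d) → ℤ) → sum (λ j → ⟦ v ≈ᵇ rep d j ⟧ * u j) ≡ u i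
  sum-reps d v i v≈i u = begin
    sum (λ j → ⟦ v ≈ᵇ rep d j ⟧ * u j)
      ≡⟨ sum-only _ i (λ j j≢i → cong (λ b → ⟦ b ⟧ * u j)
           (dec-false (v ≈? rep d j) (λ v≈j → j≢i (rep-injective d j i (≈-trans (≈-sym v≈j) v≈i))))) ⟩
    ⟦ v ≈ᵇ rep d i ⟧ * u i
      ≡⟨ cong (λ b → ⟦ b ⟧ * u i) (dec-true (v ≈? rep d i) v≈i) ⟩
    1ℤ * u i
      ≡⟨ ℤ.*-identityˡ (u i) ⟩
    u i ∎

  -- The entry counts the covering pairs between two classes. Summing over the whole lower class,
  -- instead of evaluating at its representative, lets the rows be treated by `down` and the columns
  -- by `up`.
  coverMatrix : ∀ d → Fin (#reps d) → Fin (#reps (suc d)) → ℤ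
  coverMatrix d i c = ∑ᵛ (λ v → ⟦ v ≈ᵇ rep d i ⟧ * down (λ w → ⟦ w ≈ᵇ rep (suc d) c ⟧) v)

  -- Grouping the covers of v by class turns row `i` applied to the values of `f` into the sum of
  -- `down f` over class `i`.
  coverMatrix-kernel : ∀ d {f} → Invariant f → VanishesAt d (down f) →
    ∀ i → sum (λ c → coverMatrix d i c * f (rep (suc d) c)) ≡ 0ℤ
  coverMatrix-kernel d {f} f-inv vanishes i = begin
    sum (λ c → coverMatrix d i c * f (rep (suc d) c))
      ≡⟨ sum-∑ᵛ-linear (λ v → ⟦ v ≈ᵇ rep d i ⟧) (λ c → down (λ w → ⟦ w ≈ᵇ rep (suc d) c ⟧)) (λ c → f (rep (suc d) c)) ⟩
    ∑ᵛ (λ v → ⟦ v ≈ᵇ rep d i ⟧ * sum (λ c → down (λ w → ⟦ w ≈ᵇ rep (suc d) c ⟧) v * f (rep (suc d) c)))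
      ≡⟨ ∑ᵛ-zero (λ v → ⟦⟧-*-zero (v ≈ᵇ rep d i) (λ p →
           trans (expand v (trans (≈⇒weight≡ (≈ᵇ⇒≈ p)) (weight-rep d i)))
                 (vanishes v (trans (≈⇒weight≡ (≈ᵇ⇒≈ p)) (weight-rep d i))))) ⟩
    0ℤ ∎
    where
    expand : ∀ v → weight v ≡ d →
      sum (λ c → down (λ w → ⟦ w ≈ᵇ rep (suc d) c ⟧) v * f (rep (suc d) c)) ≡ down f v
    expand v wt = trans
      (sum-∑ᵛ-linear (λ w → ⟦ v ⋖ w ⟧) (λ c w → ⟦ w ≈ᵇ rep (suc d) c ⟧) (λ c → f (rep (suc d) c)))
      (∑ᵛ-cong (λ w → ⟦⟧-*-cong (v ⋖ w) (λ v⋖w →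
        let (c , w≈c) = representative w (trans (⋖⇒weight v w v⋖w) (cong suc wt))
        in trans (sum-reps (suc d) w c w≈c (λ c → f (rep (suc d) c))) (≡.sym (f-inv w≈c)))))

  -- Coefficients on the rows amount to a function `F` constant on classes. Its combination in
  -- column c is the sum of `up F` over class c, so a vanishing combination makes `up F` vanish and
  -- `up-injective` applies.
  coverMatrix-independent : ∀ d → 2 ℕ.* d ℕ.< N → IndependentRows (coverMatrix d)
  coverMatrix-independent d 2d<N α eqs i = begin
    α i                ≡⟨ sum-reps d (rep d i) i ≈-refl α ⟨
    F (rep d i)        ≡⟨ up-injective d F 2d<N upF≡0 (rep d i) (weight-rep d i) ⟩
    0ℤ                 ∎
    where
    F : Cube N → ℤ
    F v = sum (λ j → ⟦ v ≈ᵇ rep d j ⟧ * α j)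
    F-inv : Invariant F
    F-inv p = sum-cong-≗ (λ j → cong (λ b → ⟦ b ⟧ * α j) (≈ᵇ-congˡ (rep d j) p))
    class : Fin (#reps (suc d)) → Cube N → ℤ
    class c w = ⟦ w ≈ᵇ rep (suc d) c ⟧
    row : Fin (#reps d) → Cube N → ℤ
    row j v = ⟦ v ≈ᵇ rep d j ⟧
    pairing : ∀ c → sum (λ j → α j * coverMatrix d j c) ≡ ∑ᵛ (λ w → class c w * up F w)
    pairing c = begin
      sum (λ j → α j * coverMatrix d j c)
        ≡⟨ sum-cong-≗ (λ j → trans (ℤ.*-comm (α j) (coverMatrix d j c))
             (cong (λ z → z * α j) (down-up-adjoint (class c) (row j)))) ⟩
      sum (λ j → ∑ᵛ (λ w → class c w * up (row j) w) * α j)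
        ≡⟨ sum-∑ᵛ-linear (class c) (λ j → up (row j)) α ⟩
      ∑ᵛ (λ w → class c w * sum (λ j → up (row j) w * α j))
        ≡⟨ ∑ᵛ-cong (λ w → cong (_*_ (class c w)) (sum-∑ᵛ-linear (λ v → ⟦ v ⋖ w ⟧) row α)) ⟩
      ∑ᵛ (λ w → class c w * up F w) ∎
    upF≡0 : VanishesAt (suc d) (up F)
    upF≡0 w wt = let (c , w≈c) = representative w wt in
      trans (up-invariant F-inv w≈c) (*-nonzero-cancel (orb≢0 (rep (suc d) c)) (begin
        orb (rep (suc d) c) * up F (rep (suc d) c)  ≡⟨ ∑ᵛ-class (rep (suc d) c) (up F) (up-invariant F-inv) ⟨
        ∑ᵛ (λ w → class c w * up F w)               ≡⟨ pairing c ⟨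
        sum (λ j → α j * coverMatrix d j c)         ≡⟨ eqs c ⟩
        0ℤ                                          ∎))

  vanishesAt-reps : ∀ d {f} → Invariant f → (∀ i → f (rep d i) ≡ 0ℤ) → VanishesAt d f
  vanishesAt-reps d f-inv f≡0 v wt = let (i , v≈i) = representative v wt in trans (f-inv v≈i) (f≡0 i)

  -- The list controls levels 1 to k + 1: it starts with all of level 1, and each further level
  -- contributes its free columns, as many as its number of classes exceeds the previous one.
  -- Bounding by `pred N` admits k = 0 even for N = 0.
  generators : ∀ k → 2 ℕ.* k ≤ ℕ.pred N → Σ (List (Cube N)) λ T → length T ≡ #reps (suc k) ×
    (∀ {f} → Invariant f → DownClosed f → (∀ s → s ∈ T → f s ≡ 0ℤ) → ∀ d → d ≤ k → VanishesAt (suc d) f)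
  generators zero _ = reps 1 , refl ,
    λ { f-inv _ f≡0 zero ℕ.z≤n → vanishesAt-reps 1 f-inv (λ i → f≡0 (rep 1 i) (∈-lookup i)) }
  generators (suc k) 2k+2≤ = map (rep (suc (suc k))) S ++ T , size , separates
    where
    -- The positive left side excludes m = 0, the one case in which `pred` does not decrease.
    2k<N : ∀ {n m} → suc n ≤ ℕ.pred m → suc n ℕ.< m
    2k<N {m = suc m} p = ℕ.s≤s p
    previous = generators k (ℕ.≤-trans (ℕ.*-monoʳ-≤ 2 (ℕ.n≤1+n k)) 2k+2≤)
    T = proj₁ previous
    selected = freeColumns _ _ (coverMatrix (suc k)) (coverMatrix-independent (suc k) (2k<N 2k+2≤))
    S = proj₁ selected
    size : length (map (rep (suc (suc k))) S ++ T) ≡ #reps (suc (suc k))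
    size = begin
      length (map (rep (suc (suc k))) S ++ T)              ≡⟨ length-++ (map (rep (suc (suc k))) S) ⟩
      length (map (rep (suc (suc k))) S) ℕ.+ length T      ≡⟨ cong₂ ℕ._+_ (length-map (rep (suc (suc k))) S) (proj₁ (proj₂ previous)) ⟩
      length S ℕ.+ #reps (suc k)                           ≡⟨ proj₁ (proj₂ selected) ⟩
      #reps (suc (suc k))                                  ∎
    separates : ∀ {f} → Invariant f → DownClosed f → (∀ s → s ∈ map (rep (suc (suc k))) S ++ T → f s ≡ 0ℤ) →
      ∀ d → d ≤ suc k → VanishesAt (suc d) f
    separates {f} f-inv closed f≡0 = λ d d≤1+k → go d (ℕ.m≤n⇒m<n∨m≡n d≤1+k)
      where
      vanishes : ∀ d → d ≤ k → VanishesAt (suc d) f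
      vanishes = proj₂ (proj₂ previous) f-inv closed
        (λ s s∈T → f≡0 s (∈-++⁺ʳ (map (rep (suc (suc k))) S) s∈T))
      go : ∀ d → d ℕ.< suc k ⊎ d ≡ suc k → VanishesAt (suc d) f
      go d (inj₁ (ℕ.s≤s d≤k)) = vanishes d d≤k
      -- Vanishing on level k + 1 passes to `down f`, so the values of `f` at the representatives of
      -- level k + 2 form a kernel vector, and those at the free columns are zero.
      go _ (inj₂ refl) = vanishesAt-reps (suc (suc k)) f-inv
        (proj₂ (proj₂ selected) (λ c → f (rep (suc (suc k)) c))
          (coverMatrix-kernel (suc k) f-inv (closed (vanishes 0 ℕ.z≤n) (suc k) (vanishes k ℕ.≤-refl)))
          (λ c c∈S → f≡0 _ (∈-++⁺ˡ (∈-map⁺ (rep (suc (suc k))) c∈S))))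

  -- Pigeonhole: two representatives matched to the same entry of `L` would be equivalent.
  #reps-minimal : ∀ d (L : List (Cube N)) → (∀ v → weight v ≡ d → Any (v ≈_) L) → #reps d ≤ length L
  #reps-minimal d L cover = injective⇒≤ {f = λ i → Any.index (cover (rep d i) (weight-rep d i))}
    (λ {i} {j} eq → rep-injective d i j (SetoidMembership.index-injective (DecSetoid.setoid decSetoid)
      (cover (rep d i) (weight-rep d i)) (cover (rep d j) (weight-rep d j)) eq))

  -- The levels covered are 1 to max(1, ⌊N/2⌋). Level 1 is kept even if ⌊N/2⌋ is 0, since it serves
  -- to compare weights.
  separators : List (Cube N)
  separators = proj₁ (generators (ℕ.pred ⌊ N /2⌋) (2*pred[n/2]≤pred N))

  separators-minimal : ∀ (L : List (Cube N)) → (∀ v → weight v ≡ ⌊ N /2⌋ → Any (v ≈_) L) →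
    length separators ≤ length L
  separators-minimal L cover = ℕ.≤-trans
    (ℕ.≤-reflexive (proj₁ (proj₂ (generators (ℕ.pred ⌊ N /2⌋) (2*pred[n/2]≤pred N)))))
    (go ⌊ N /2⌋ refl)
    where
    go : ∀ h → ⌊ N /2⌋ ≡ h → #reps (suc (ℕ.pred h)) ≤ length L
    go (suc h) eq = #reps-minimal (suc h) L (λ v wt → cover v (trans wt (≡.sym eq)))
    -- Here N ≤ 1, so level 1 has at most one point, while covering the empty graph forces `L` to
    -- have an entry.
    go zero    eq = ℕ.≤-trans
      (#reps-minimal 1 (replicate N true ∷ []) (λ v wt →
        here (≡.subst (v ≈_) (weight≡1⇒full N≤1 v wt) ≈-refl)))
      (Any⇒length>0 (cover (replicate N false) (trans (weight-replicate-false N) (≡.sym eq))))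
      where
      N≤1 : N ≤ 1
      N≤1 = ℕ.s≤s⁻¹ (≡.subst (λ h → N ℕ.< 2 ℕ.* suc h) eq (n<2[1+n/2] N))

  separators-separate : ∀ x y → (∀ s → s ∈ separators → below s x ≡ below s y) → x ≈ y
  separators-separate x y eqs = difference-self≡0⇒≈ x y
    (difference-weight x y (vanishes 1)) (vanishes (weight x) x refl)
    where
    k = ℕ.pred ⌊ N /2⌋
    f = difference x y
    closed = difference-downClosed x y
    low : ∀ d → d ≤ k → VanishesAt (suc d) f
    low = proj₂ (proj₂ (generators k (2*pred[n/2]≤pred N))) (difference-invariant x y) closed
      (λ s s∈T → difference≡0 x y s (eqs s s∈T))
    N/2≤1+k : ⌊ N /2⌋ ≤ suc k
    N/2≤1+k = n≤1+pred[n] ⌊ N /2⌋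
    vanishes : ∀ d → VanishesAt d f
    vanishes zero    = difference-at-0 x y
    vanishes (suc d) with ℕ.≤-<-connex d k
    ... | inj₁ d≤k = low d d≤k
    -- Level d + 1 exceeds ⌊N/2⌋, so vanishing climbs from level d by injectivity of `down`.
    ... | inj₂ k<d = down-injective d f
      (ℕ.<-≤-trans (n<2[1+n/2] N) (ℕ.*-monoʳ-≤ 2 (ℕ.s≤s (ℕ.≤-trans N/2≤1+k k<d))))
      (closed (low 0 ℕ.z≤n) d (vanishes d))

-- Graphs as points of the cube

≅-isEquivalence : ∀ {n} → IsEquivalence (_≅_ {n})
≅-isEquivalence = record
  { refl  = ↔-refl , λ i j → refl
  ; sym   = λ {g} {h} (σ , e) → ↔-sym σ , λ i j → ≡.sym (trans
      (e (Inverse.from σ i) (Inverse.from σ j))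
      (cong₂ (adj h) (Inverse.strictlyInverseˡ σ i) (Inverse.strictlyInverseˡ σ j)))
  ; trans = λ (σ , e) (τ , f) → ↔-trans σ τ , λ i j → trans (e i j) (f (Inverse.to σ i) (Inverse.to σ j))
  }

≗ᴳ⇒≅ : ∀ {n} {g h : Graph n} → g ≗ᴳ h → g ≅ h
≗ᴳ⇒≅ g≗h = ↔-refl , g≗h

IsIsomorphism : ∀ {n} → Graph n → Graph n → (Fin n → Fin n) → (Fin n → Fin n) → Set
IsIsomorphism g h to from =
  (∀ i → to (from i) ≡ i) × (∀ i → from (to i) ≡ i) × (∀ i j → adj g i j ≡ adj h (to i) (to j))

isIsomorphism? : ∀ {n} (g h : Graph n) to from → Dec (IsIsomorphism g h to from)
isIsomorphism? g h to from =
  all? (λ i → to (from i) Fin.≟ i) ×-dec all? (λ i → from (to i) Fin.≟ i) ×-dec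
  all? (λ i → all? (λ j → adj g i j Bool.≟ adj h (to i) (to j)))

-- Needed for the exhaustive search in `_≅?_`: a map decoded from its code in a finite type agrees
-- with the original only pointwise.
IsIsomorphism-cong : ∀ {n} {g h : Graph n} {to to′ from from′} →
  (∀ i → to′ i ≡ to i) → (∀ i → from′ i ≡ from i) → IsIsomorphism g h to from → IsIsomorphism g h to′ from′
IsIsomorphism-cong {h = h} {to} {to′} {from} {from′} to≗ from≗ (invˡ , invʳ , e) =
  (λ i → trans (cong to′ (from≗ i)) (trans (to≗ (from i)) (invˡ i))) ,
  (λ i → trans (cong from′ (to≗ i)) (trans (from≗ (to i)) (invʳ i))) ,
  (λ i j → trans (e i j) (≡.sym (cong₂ (adj h) (to≗ i) (to≗ j))))

_≅?_ : ∀ {n} (g h : Graph n) → Dec (g ≅ h)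
g ≅? h = map′
  (λ (k , l , invˡ , invʳ , e) → mk↔ₛ′ (finToFun k) (finToFun l) invˡ invʳ , e)
  (λ (σ , e) → funToFin (Inverse.to σ) , funToFin (Inverse.from σ) ,
     IsIsomorphism-cong {g = g} {h} (finToFun-funToFin (Inverse.to σ)) (finToFun-funToFin (Inverse.from σ))
       (Inverse.strictlyInverseˡ σ , Inverse.strictlyInverseʳ σ , e))
  (any? (λ k → any? (λ l → isIsomorphism? g h (finToFun k) (finToFun l))))

-- This form of `n C 2` computes along the layout of the bits: first the n edges at vertex zero,
-- then the graph on the other vertices.
pairs : ℕ → ℕ
pairs zero    = 0
pairs (suc n) = n ℕ.+ pairs n

pairs≡nC2 : ∀ n → pairs n ≡ n C 2
pairs≡nC2 zero    = refl
pairs≡nC2 (suc n) = trans (cong₂ ℕ._+_ (≡.sym (nC1≡n n)) (pairs≡nC2 n)) (nCk+nC[k+1]≡[n+1]C[k+1] n 1)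

toAdj : ∀ n → Cube (pairs n) → Fin n → Fin n → Bool
toAdj (suc n) v zero    zero    = false
toAdj (suc n) v zero    (suc j) = Vec.lookup (Vec.take n v) j
toAdj (suc n) v (suc i) zero    = Vec.lookup (Vec.take n v) i
toAdj (suc n) v (suc i) (suc j) = toAdj n (Vec.drop n v) i j

fromAdj : ∀ {n} → (Fin n → Fin n → Bool) → Cube (pairs n)
fromAdj {zero}  a = []
fromAdj {suc n} a = Vec.tabulate (λ j → a zero (suc j)) Vec.++ fromAdj (λ i j → a (suc i) (suc j))

toAdj-sym : ∀ n (v : Cube (pairs n)) i j → toAdj n v i j ≡ toAdj n v j i
toAdj-sym (suc n) v zero    zero    = refl
toAdj-sym (suc n) v zero    (suc j) = refl
toAdj-sym (suc n) v (suc i) zero    = refl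
toAdj-sym (suc n) v (suc i) (suc j) = toAdj-sym n (Vec.drop n v) i j

toAdj-irr : ∀ n (v : Cube (pairs n)) i → toAdj n v i i ≡ false
toAdj-irr (suc n) v zero    = refl
toAdj-irr (suc n) v (suc i) = toAdj-irr n (Vec.drop n v) i

fromAdj-cong : ∀ {n} {a b : Fin n → Fin n → Bool} → (∀ i j → a i j ≡ b i j) → fromAdj a ≡ fromAdj b
fromAdj-cong {zero}  a≗b = refl
fromAdj-cong {suc n} a≗b = cong₂ Vec._++_ (Vec.tabulate-cong (λ j → a≗b zero (suc j)))
  (fromAdj-cong (λ i j → a≗b (suc i) (suc j)))

fromAdj-toAdj : ∀ n (v : Cube (pairs n)) → fromAdj (toAdj n v) ≡ v
fromAdj-toAdj zero  [] = refl
fromAdj-toAdj (suc n) v = trans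
  (cong₂ Vec._++_ (Vec.tabulate∘lookup (Vec.take n v)) (fromAdj-toAdj n (Vec.drop n v)))
  (Vec.take++drop≡id n v)

take-++ : ∀ {A : Set} {m n} (xs : Vec A m) (ys : Vec A n) → Vec.take m (xs Vec.++ ys) ≡ xs
take-++ {m = m} xs ys = Vec.++-injectiveˡ _ xs (Vec.take++drop≡id m (xs Vec.++ ys))

drop-++ : ∀ {A : Set} {m n} (xs : Vec A m) (ys : Vec A n) → Vec.drop m (xs Vec.++ ys) ≡ ys
drop-++ {m = m} xs ys = Vec.++-injectiveʳ _ xs (Vec.take++drop≡id m (xs Vec.++ ys))

toAdj-fromAdj : ∀ {n} (a : Fin n → Fin n → Bool) → (∀ i j → a i j ≡ a j i) → (∀ i → a i i ≡ false) →
  ∀ i j → toAdj n (fromAdj a) i j ≡ a i j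
toAdj-fromAdj {suc n} a a-sym a-irr = λ where
    zero    zero    → ≡.sym (a-irr zero)
    zero    (suc j) → row-lookup j
    (suc i) zero    → trans (row-lookup i) (a-sym zero (suc i))
    (suc i) (suc j) → trans (cong (λ v → toAdj n v i j) (drop-++ row rest))
      (toAdj-fromAdj (λ i j → a (suc i) (suc j)) (λ i j → a-sym (suc i) (suc j)) (λ i → a-irr (suc i)) i j)
  where
  row : Cube n
  row = Vec.tabulate (λ j → a zero (suc j))
  rest : Cube (pairs n)
  rest = fromAdj (λ i j → a (suc i) (suc j))
  row-lookup : ∀ j → Vec.lookup (Vec.take n (row Vec.++ rest)) j ≡ a zero (suc j)
  row-lookup j = trans (cong (λ v → Vec.lookup v j) (take-++ row rest)) (Vec.lookup∘tabulate (λ j → a zero (suc j)) j)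

toGraph : ∀ n → Cube (pairs n) → Graph n
toGraph n v = record { adj = toAdj n v ; sym = toAdj-sym n v ; irr = toAdj-irr n v }

fromGraph : ∀ {n} → Graph n → Cube (pairs n)
fromGraph g = fromAdj (adj g)

toGraph-fromGraph : ∀ {n} (g : Graph n) → toGraph n (fromGraph g) ≗ᴳ g
toGraph-fromGraph g = toAdj-fromAdj (adj g) (Graph.sym g) (irr g)

toGraph-injective : ∀ n {v w : Cube (pairs n)} → toGraph n v ≗ᴳ toGraph n w → v ≡ w
toGraph-injective n {v} {w} p = trans (≡.sym (fromAdj-toAdj n v)) (trans (fromAdj-cong p) (fromAdj-toAdj n w))

≼⇒lookup : ∀ {n} (v w : Cube n) → v ≼ w ≡ true → ∀ i → Vec.lookup v i ≡ true → Vec.lookup w i ≡ true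
≼⇒lookup (true ∷ v)  (true ∷ w) p zero    q = refl
≼⇒lookup (false ∷ v) (_ ∷ w)    p (suc i) q = ≼⇒lookup v w p i q
≼⇒lookup (true ∷ v)  (true ∷ w) p (suc i) q = ≼⇒lookup v w p i q

lookup⇒≼ : ∀ {n} (v w : Cube n) → (∀ i → Vec.lookup v i ≡ true → Vec.lookup w i ≡ true) → v ≼ w ≡ true
lookup⇒≼ []          []          _ = refl
lookup⇒≼ (false ∷ v) (_ ∷ w)     p = lookup⇒≼ v w (λ i → p (suc i))
lookup⇒≼ (true ∷ v)  (false ∷ w) p = p zero refl
lookup⇒≼ (true ∷ v)  (true ∷ w)  p = lookup⇒≼ v w (λ i → p (suc i))

take-≼ : ∀ m {n} (v w : Cube (m ℕ.+ n)) → v ≼ w ≡ true → Vec.take m v ≼ Vec.take m w ≡ true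
take-≼ zero    v           w          p = refl
take-≼ (suc m) (false ∷ v) (_ ∷ w)    p = take-≼ m v w p
take-≼ (suc m) (true ∷ v)  (true ∷ w) p = take-≼ m v w p

drop-≼ : ∀ m {n} (v w : Cube (m ℕ.+ n)) → v ≼ w ≡ true → Vec.drop m v ≼ Vec.drop m w ≡ true
drop-≼ zero    v           w          p = p
drop-≼ (suc m) (false ∷ v) (_ ∷ w)    p = drop-≼ m v w p
drop-≼ (suc m) (true ∷ v)  (true ∷ w) p = drop-≼ m v w p

take∧drop-≼ : ∀ m {n} (v w : Cube (m ℕ.+ n)) → Vec.take m v ≼ Vec.take m w ≡ true →
  Vec.drop m v ≼ Vec.drop m w ≡ true → v ≼ w ≡ true
take∧drop-≼ zero    v           w          p q = q
take∧drop-≼ (suc m) (false ∷ v) (_ ∷ w)    p q = take∧drop-≼ m v w p q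
take∧drop-≼ (suc m) (true ∷ v)  (true ∷ w) p q = take∧drop-≼ m v w p q

≼⇒⊆ᴳ : ∀ n (v w : Cube (pairs n)) → v ≼ w ≡ true → toGraph n v ⊆ᴳ toGraph n w
≼⇒⊆ᴳ (suc n) v w p zero    (suc j) = ≼⇒lookup (Vec.take n v) (Vec.take n w) (take-≼ n v w p) j
≼⇒⊆ᴳ (suc n) v w p (suc i) zero    = ≼⇒lookup (Vec.take n v) (Vec.take n w) (take-≼ n v w p) i
≼⇒⊆ᴳ (suc n) v w p (suc i) (suc j) = ≼⇒⊆ᴳ n (Vec.drop n v) (Vec.drop n w) (drop-≼ n v w p) i j

⊆ᴳ⇒≼ : ∀ n (v w : Cube (pairs n)) → toGraph n v ⊆ᴳ toGraph n w → v ≼ w ≡ true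
⊆ᴳ⇒≼ zero  [] [] _ = refl
⊆ᴳ⇒≼ (suc n) v  w  p = take∧drop-≼ n v w
  (lookup⇒≼ (Vec.take n v) (Vec.take n w) (λ j → p zero (suc j)))
  (⊆ᴳ⇒≼ n (Vec.drop n v) (Vec.drop n w) (λ i j → p (suc i) (suc j)))

relabel : ∀ {n} → (Fin n → Fin n) → Graph n → Graph n
relabel φ g = record
  { adj = λ i j → adj g (φ i) (φ j)
  ; sym = λ i j → Graph.sym g (φ i) (φ j)
  ; irr = λ i → irr g (φ i)
  }

relabelCube : ∀ n → (Fin n → Fin n) → Cube (pairs n) → Cube (pairs n)
relabelCube n φ v = fromGraph (relabel φ (toGraph n v))

toAdj-relabelCube : ∀ n (φ : Fin n → Fin n) v i j → toAdj n (relabelCube n φ v) i j ≡ toAdj n v (φ i) (φ j)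
toAdj-relabelCube n φ v = toGraph-fromGraph (relabel φ (toGraph n v))

relabelCube-inverse : ∀ n (φ ψ : Fin n → Fin n) → (∀ i → φ (ψ i) ≡ i) → ∀ v → relabelCube n ψ (relabelCube n φ v) ≡ v
relabelCube-inverse n φ ψ inv v = toGraph-injective n λ i j → begin
  toAdj n (relabelCube n ψ (relabelCube n φ v)) i j  ≡⟨ toAdj-relabelCube n ψ (relabelCube n φ v) i j ⟩
  toAdj n (relabelCube n φ v) (ψ i) (ψ j)            ≡⟨ toAdj-relabelCube n φ v (ψ i) (ψ j) ⟩
  toAdj n v (φ (ψ i)) (φ (ψ j))                      ≡⟨ cong₂ (toAdj n v) (inv i) (inv j) ⟩
  toAdj n v i j                                      ∎

relabelCube-mono : ∀ n (φ : Fin n → Fin n) v w → v ≼ w ≡ true → relabelCube n φ v ≼ relabelCube n φ w ≡ true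
relabelCube-mono n φ v w p = ⊆ᴳ⇒≼ n _ _ λ i j q → trans (toAdj-relabelCube n φ w i j)
  (≼⇒⊆ᴳ n v w p (φ i) (φ j) (trans (≡.sym (toAdj-relabelCube n φ v i j)) q))

relabelling : ∀ {n} → Fin n ↔ Fin n → Automorphism (pairs n)
relabelling {n} σ = record
  -- `relabel` pulls adjacency back, so edges move forward along σ when relabelled by its inverse.
  { to        = relabelCube n from
  ; from      = relabelCube n to
  ; from∘to   = relabelCube-inverse n from to strictlyInverseʳ
  ; to∘from   = relabelCube-inverse n to from strictlyInverseˡ
  ; to-mono   = relabelCube-mono n from
  ; from-mono = relabelCube-mono n to
  } where open Inverse σ using (to; from; strictlyInverseˡ; strictlyInverseʳ)

Isomorphic : ∀ n → Cube (pairs n) → Cube (pairs n) → Set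
Isomorphic n v w = toGraph n v ≅ toGraph n w

-- The isomorphism σ, acting on all graphs at once, is the automorphism; it relates every graph z to
-- its image.
relabelling-transports : ∀ n {v w : Cube (pairs n)} → Isomorphic n v w → Σ (Automorphism (pairs n)) λ τ →
  Automorphism.to τ v ≡ w × (∀ z → Isomorphic n z (Automorphism.to τ z))
relabelling-transports n {v} {w} (σ , e) = relabelling σ ,
  toGraph-injective n (λ i j → trans (toAdj-relabelCube n from v i j) (trans (e (from i) (from j))
    (cong₂ (toAdj n w) (strictlyInverseˡ i) (strictlyInverseˡ j)))) ,
  λ z → σ , λ i j → ≡.sym (trans (toAdj-relabelCube n from z (to i) (to j))
    (cong₂ (toAdj n z) (strictlyInverseʳ i) (strictlyInverseʳ j)))
  where open Inverse σ using (to; from; strictlyInverseˡ; strictlyInverseʳ)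

Isomorphic-isEquivalence : ∀ n → IsEquivalence (Isomorphic n)
Isomorphic-isEquivalence n = On.isEquivalence (toGraph n) ≅-isEquivalence

-- Edge counts as weights

weight-++ : ∀ {m n} (v : Cube m) (w : Cube n) → weight (v Vec.++ w) ≡ weight v ℕ.+ weight w
weight-++ []          w = refl
weight-++ (false ∷ v) w = weight-++ v w
weight-++ (true ∷ v)  w = cong suc (weight-++ v w)

bit : Bool → ℕ
bit b = if b then 1 else 0

sum-tabulate-bit : ∀ {n} (f : Fin n → Bool) → sumᴸ (List.tabulate (λ j → bit (f j))) ≡ weight (Vec.tabulate f)
sum-tabulate-bit {zero}  f = refl
sum-tabulate-bit {suc n} f with f zero
... | false = sum-tabulate-bit (λ j → f (suc j))
... | true  = cong suc (sum-tabulate-bit (λ j → f (suc j)))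

filterᵇ-map : ∀ {A B : Set} (p : B → Bool) (f : A → B) xs → filterᵇ p (map f xs) ≡ map f (filterᵇ (λ x → p (f x)) xs)
filterᵇ-map p f []       = refl
filterᵇ-map p f (x ∷ xs) with p (f x)
... | false = filterᵇ-map p f xs
... | true  = cong (f x ∷_) (filterᵇ-map p f xs)

edgeBits : ∀ {n} → (Fin n → Fin n → Bool) → Fin n → List ℕ
edgeBits {n} a i = map (λ j → bit (a i j)) (filterᵇ (λ j → toℕ i ℕ.<ᵇ toℕ j) (allFin n))

-- Peel off vertex zero: the filter i < j keeps its row except the diagonal entry and drops column
-- zero from all other rows, which shift to the smaller graph.
sum-edgeBits : ∀ {n} (a : Fin n → Fin n → Bool) → sumᴸ (concatMap (edgeBits a) (allFin n)) ≡ weight (fromAdj a)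
sum-edgeBits {zero}  a = refl
sum-edgeBits {suc n} a = begin
  sumᴸ (edgeBits a zero ++ concatMap (edgeBits a) (List.tabulate suc))
    ≡⟨ sum-++ (edgeBits a zero) _ ⟩
  sumᴸ (edgeBits a zero) ℕ.+ sumᴸ (concatMap (edgeBits a) (List.tabulate suc))
    ≡⟨ cong₂ ℕ._+_ (trans (cong sumᴸ firstRow) (sum-tabulate-bit (λ j → a zero (suc j))))
         (trans (cong sumᴸ otherRows) (sum-edgeBits (λ i j → a (suc i) (suc j)))) ⟩
  weight (Vec.tabulate (λ j → a zero (suc j))) ℕ.+ weight (fromAdj (λ i j → a (suc i) (suc j)))
    ≡⟨ weight-++ (Vec.tabulate (λ j → a zero (suc j))) _ ⟨
  weight (fromAdj a) ∎
  where
  sucs : List.tabulate suc ≡ map suc (allFin n)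
  sucs = ≡.sym (map-tabulate (λ i → i) suc)
  filter-all : ∀ {A : Set} (xs : List A) → filterᵇ (λ _ → true) xs ≡ xs
  filter-all []       = refl
  filter-all (x ∷ xs) = cong (x ∷_) (filter-all xs)
  firstRow : edgeBits a zero ≡ List.tabulate (λ j → bit (a zero (suc j)))
  firstRow = begin
    map (λ j → bit (a zero j)) (filterᵇ (λ j → 0 ℕ.<ᵇ toℕ j) (List.tabulate suc))
      ≡⟨ cong (λ xs → map (λ j → bit (a zero j)) (filterᵇ (λ j → 0 ℕ.<ᵇ toℕ j) xs)) sucs ⟩
    map (λ j → bit (a zero j)) (filterᵇ (λ j → 0 ℕ.<ᵇ toℕ j) (map suc (allFin n)))
      ≡⟨ cong (map (λ j → bit (a zero j))) (filterᵇ-map (λ j → 0 ℕ.<ᵇ toℕ j) suc (allFin n)) ⟩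
    map (λ j → bit (a zero j)) (map suc (filterᵇ (λ _ → true) (allFin n)))
      ≡⟨ cong (λ xs → map (λ j → bit (a zero j)) (map suc xs)) (filter-all (allFin n)) ⟩
    map (λ j → bit (a zero j)) (map suc (allFin n))
      ≡⟨ map-∘ (allFin n) ⟨
    map (λ j → bit (a zero (suc j))) (allFin n)
      ≡⟨ map-tabulate (λ i → i) (λ j → bit (a zero (suc j))) ⟩
    List.tabulate (λ j → bit (a zero (suc j))) ∎
  otherRow : ∀ i → edgeBits a (suc i) ≡ edgeBits (λ i j → a (suc i) (suc j)) i
  otherRow i = begin
    map (λ j → bit (a (suc i) j)) (filterᵇ (λ j → suc (toℕ i) ℕ.<ᵇ toℕ j) (List.tabulate suc))
      ≡⟨ cong (λ xs → map (λ j → bit (a (suc i) j)) (filterᵇ (λ j → suc (toℕ i) ℕ.<ᵇ toℕ j) xs)) sucs ⟩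
    map (λ j → bit (a (suc i) j)) (filterᵇ (λ j → suc (toℕ i) ℕ.<ᵇ toℕ j) (map suc (allFin n)))
      ≡⟨ cong (map (λ j → bit (a (suc i) j))) (filterᵇ-map (λ j → suc (toℕ i) ℕ.<ᵇ toℕ j) suc (allFin n)) ⟩
    map (λ j → bit (a (suc i) j)) (map suc (filterᵇ (λ j → toℕ i ℕ.<ᵇ toℕ j) (allFin n)))
      ≡⟨ map-∘ (filterᵇ (λ j → toℕ i ℕ.<ᵇ toℕ j) (allFin n)) ⟨
    edgeBits (λ i j → a (suc i) (suc j)) i ∎
  otherRows : concatMap (edgeBits a) (List.tabulate suc) ≡
              concatMap (edgeBits (λ i j → a (suc i) (suc j))) (allFin n)
  otherRows = begin
    concatMap (edgeBits a) (List.tabulate suc)             ≡⟨ cong (concatMap (edgeBits a)) sucs ⟩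
    concatMap (edgeBits a) (map suc (allFin n))            ≡⟨ concatMap-map (edgeBits a) suc (allFin n) ⟩
    concatMap (λ i → edgeBits a (suc i)) (allFin n)        ≡⟨ concatMap-cong otherRow (allFin n) ⟩
    concatMap (edgeBits (λ i j → a (suc i) (suc j))) (allFin n) ∎

edgeCount-toGraph : ∀ n (v : Cube (pairs n)) → edgeCount (toGraph n v) ≡ weight v
edgeCount-toGraph n v = trans (sum-edgeBits (toAdj n v)) (cong weight (fromAdj-toAdj n v))

-- Counting subgraphs as sums over the cube

cubes-unique : ∀ n → Unique (cubes n)
cubes-unique zero    = [] ∷ []
cubes-unique (suc n) = Unique.++⁺ (Unique.map⁺ Vec.∷-injectiveʳ (cubes-unique n))
  (Unique.map⁺ Vec.∷-injectiveʳ (cubes-unique n)) disjoint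
  where
  disjoint : ∀ {v} → v ∈ map (false ∷_) (cubes n) × v ∈ map (true ∷_) (cubes n) → ⊥
  disjoint (p , q) with ∈-map⁻ (false ∷_) p | ∈-map⁻ (true ∷_) q
  ... | _ , _ , refl | _ , _ , ()

length-filter-map : ∀ {A B : Set} {P : B → Set} (P? : ∀ b → Dec (P b)) (f : A → B) xs →
  length (filter P? (map f xs)) ≡ length (filter (λ a → P? (f a)) xs)
length-filter-map P? f []       = refl
length-filter-map P? f (x ∷ xs) with does (P? (f x))
... | false = length-filter-map P? f xs
... | true  = cong suc (length-filter-map P? f xs)

length-filter-cubes : ∀ {n} {P : Cube n → Set} (P? : ∀ v → Dec (P v)) →
  + length (filter P? (cubes n)) ≡ ∑ᵛ (λ v → ⟦ does (P? v) ⟧)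
length-filter-cubes {zero} P? with does (P? [])
... | false = refl
... | true  = refl
length-filter-cubes {suc n} P? = begin
  + length (filter P? (map (false ∷_) (cubes n) ++ map (true ∷_) (cubes n)))
    ≡⟨ cong (λ xs → + length xs) (filter-++ P? (map (false ∷_) (cubes n)) (map (true ∷_) (cubes n))) ⟩
  + length (filter P? (map (false ∷_) (cubes n)) ++ filter P? (map (true ∷_) (cubes n)))
    ≡⟨ cong +_ (length-++ (filter P? (map (false ∷_) (cubes n)))) ⟩
  + (length (filter P? (map (false ∷_) (cubes n))) ℕ.+ length (filter P? (map (true ∷_) (cubes n))))
    ≡⟨ cong₂ (λ a b → + (a ℕ.+ b)) (length-filter-map P? (false ∷_) (cubes n)) (length-filter-map P? (true ∷_) (cubes n)) ⟩
  + length (filter (λ v → P? (false ∷ v)) (cubes n)) + + length (filter (λ v → P? (true ∷ v)) (cubes n))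
    ≡⟨ cong₂ _+_ (length-filter-cubes (λ v → P? (false ∷ v))) (length-filter-cubes (λ v → P? (true ∷ v))) ⟩
  ∑ᵛ (λ v → ⟦ does (P? v) ⟧) ∎

⟦∧⟧ : ∀ b c → ⟦ b ∧ c ⟧ ≡ ⟦ b ⟧ * ⟦ c ⟧
⟦∧⟧ true  c = ≡.sym (ℤ.*-identityˡ ⟦ c ⟧)
⟦∧⟧ false c = refl

does-≟true : ∀ b → does (b Bool.≟ true) ≡ b
does-≟true true  = refl
does-≟true false = refl

module GraphOrbits (n : ℕ) where
  open Orbits {pairs n} (Isomorphic n) (λ v w → toGraph n v ≅? toGraph n w) (Isomorphic-isEquivalence n) (relabelling-transports n) public
  open IsEquivalence (≅-isEquivalence {n}) using () renaming (sym to ≅-sym; trans to ≅-trans) public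

  toGraph-fromGraph-≅ : ∀ (g : Graph n) → toGraph n (fromGraph g) ≅ g
  toGraph-fromGraph-≅ g = ≗ᴳ⇒≅ {g = toGraph n (fromGraph g)} {g} (toGraph-fromGraph g)

  -- Each graph is pointwise equal to the image of exactly one cube point, so filtering the cube
  -- lists every subgraph once.
  iCount : ∀ s x → Σ ℕ λ k → ICount (toGraph n s) x k × + k ≡ below s (fromGraph x)
  iCount s x = length L , (L , sound , distinct , complete , refl) , (begin
    + length L                                              ≡⟨ cong +_ (length-map (toGraph n) (filter P? (cubes (pairs n)))) ⟩
    + length (filter P? (cubes (pairs n)))                  ≡⟨ length-filter-cubes P? ⟩
    ∑ᵛ (λ z → ⟦ does (P? z) ⟧)                              ≡⟨ ∑ᵛ-cong (λ z → trans (⟦∧⟧ (z ≈ᵇ s) _)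
                                                                 (cong (λ b → ⟦ z ≈ᵇ s ⟧ * ⟦ b ⟧) (does-≟true (z ≼ fromGraph x)))) ⟩
    below s (fromGraph x)                                   ∎)
    where
    P? : ∀ z → Dec (Isomorphic n z s × z ≼ fromGraph x ≡ true)
    P? z = (toGraph n z ≅? toGraph n s) ×-dec ((z ≼ fromGraph x) Bool.≟ true)
    L : List (Graph n)
    L = map (toGraph n) (filter P? (cubes (pairs n)))
    sound : All (λ y → (y ⊆ᴳ x) × (y ≅ toGraph n s)) L
    sound = All.map⁺ (All.map (λ {z} (z≅s , z≼x) →
      (λ i j p → trans (≡.sym (toGraph-fromGraph x i j)) (≼⇒⊆ᴳ n z (fromGraph x) z≼x i j p)) , z≅s)
      (All.all-filter P? (cubes (pairs n))))
    distinct : AllPairs (λ a b → ¬ (a ≗ᴳ b)) L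
    distinct = AllPairs.map⁺ (AllPairs.map (λ v≢w p → v≢w (toGraph-injective n p))
      (Unique.filter⁺ P? (cubes-unique (pairs n))))
    complete : ∀ y → (y ⊆ᴳ x) × (y ≅ toGraph n s) → Any (λ b → y ≗ᴳ b) L
    complete y (y⊆x , y≅s) = Any.map⁺ (Any.map (λ { refl i j → ≡.sym (toGraph-fromGraph y i j) })
      (∈-filter⁺ P? (∈-cubes (fromGraph y))
        ( ≅-trans {toGraph n (fromGraph y)} {y} {toGraph n s} (toGraph-fromGraph-≅ y) y≅s
        , ⊆ᴳ⇒≼ n (fromGraph y) (fromGraph x) (λ i j p → trans (toGraph-fromGraph x i j)
            (y⊆x i j (trans (≡.sym (toGraph-fromGraph y i j)) p))))))

theorem24 : (n : ℕ) → 1 ≤ n →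
    Σ (List (Graph n)) λ S →
    (∀ k → HCount n (halfEdges n) k → length S ≤ k) ×
    (∀ x y → (∀ s → s ∈ S → ∀ a b → ICount s x a → ICount s y b → a ≡ b) →
    x ≅ y)
theorem24 n _ = map (toGraph n) separators , minimal , separate
  where
  open GraphOrbits n
  minimal : ∀ k → HCount n (halfEdges n) k → length (map (toGraph n) separators) ≤ k
  -- Edge counts being weights and `n C 2` being `pairs n`, completeness of `L` makes it cover the
  -- middle level of the cube.
  minimal k (L , _ , _ , complete , refl) = ≡.subst₂ _≤_
    (≡.sym (length-map (toGraph n) separators)) (length-map fromGraph L)
    (separators-minimal (map fromGraph L) λ v wt → Any.map⁺ (Any.map
      (λ {g} v≅g → ≅-trans {toGraph n v} {g} {toGraph n (fromGraph g)} v≅g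
         (≅-sym {toGraph n (fromGraph g)} {g} (toGraph-fromGraph-≅ g)))
      (complete (toGraph n v) (trans (edgeCount-toGraph n v) (trans wt (cong ⌊_/2⌋ (pairs≡nC2 n)))))))
  separate : ∀ x y → (∀ s → s ∈ map (toGraph n) separators → ∀ a b → ICount s x a → ICount s y b → a ≡ b) → x ≅ y
  separate x y eqs = ≅-trans {x} {toGraph n (fromGraph x)} {y}
    (≅-sym {toGraph n (fromGraph x)} {x} (toGraph-fromGraph-≅ x))
    (≅-trans {toGraph n (fromGraph x)} {toGraph n (fromGraph y)} {y}
      -- The hypothesis, applied to the counts from `iCount`, equates the two values of `below`.
      (separators-separate (fromGraph x) (fromGraph y) λ s s∈ →
        let (a , A , a≡) = iCount s x
            (b , B , b≡) = iCount s y
        in trans (≡.sym a≡) (trans (cong +_ (eqs (toGraph n s) (∈-map⁺ (toGraph n) s∈) a b A B)) b≡))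
      (toGraph-fromGraph-≅ y))
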